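{- Let $k\geq 3$ be an integer and let $G$ be a finite simple graph. If $$\sum_{0\leq j\leq k-1} c_{2j+1}(G-X)\leq \frac{5}{6k^{2}}|X| \quad\text{for all } X\subseteq V(G),$$ then $G$ has a $\{P_{2},P_{2k+1}\}$-factor.
   Context: For a graph $H$ and an integer $j\geq 1$, $c_{j}(H)$ denotes the number of connected components of $H$ having exactly $j$ vertices. $P_n$ denotes the path on $n$ vertices. For a set $\mathcal{F}$ of connected graphs, an $\mathcal{F}$-factor of $G$ is a spanning subgraph of $G$ each of whose components is isomorphic to a member of $\mathcal{F}$. -}

module Defs where

open import Level using (0ℓ; suc)
open import Data.Bool.Properties using () renaming (_≟_ to _≟ᵇ_)
open import Data.Fin using (Fin; toℕ)
open import Data.Fin.Properties using () renaming (_≟_ to _≟ᶠ_)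
open import Data.Fin.Subset using (Subset; _∈_; _∩_; ∁; ⊤; ∣_∣)
open import Data.Fin.Subset.Properties using (_∈?_; ∈⊤; x∈p∩q⁺)
open import Data.List using (List; []; _∷_; allFin; deduplicate; filter; length; map)
open import Data.List.Membership.Propositional using () renaming (_∈_ to _∈ˡ_)
open import Data.List.Membership.Propositional.Properties using (∈-allFin)
open import Data.List.Relation.Unary.Any using (here; there)
open import Data.Nat as ℕ using (ℕ; _*_; _^_; _≤_; NonZero)
open import Data.Nat.Properties using (1+n≢n; m*n≢0; m^n≢0)
open import Data.Product using (Σ; ∃; _×_; _,_; proj₁; proj₂)
open import Data.Sum using (_⊎_; inj₁; inj₂; swap; [_,_])
open import Data.Vec using (tabulate)
open import Data.Vec.Properties using (≡-dec)
open import Function.Base using (id)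
open import Function.Bundles using (_↔_; _⇔_; Inverse)
open import Relation.Binary.Core using (Rel; _⇒_)
open import Relation.Binary.Definitions using (Decidable; DecidableEquality; Irreflexive; Symmetric)
open import Relation.Binary.Construct.Closure.ReflexiveTransitive using (Star; ε; _◅_; _◅◅_)
open import Relation.Binary.PropositionalEquality using (_≡_; refl)
open import Relation.Nullary.Decidable using (does; map′; _×-dec_; _⊎-dec_)
open import Relation.Unary using (Pred)

-- Finite simple graphs whose vertices are drawn from Fin n. The vertex set may
-- be a proper subset of Fin n, so that deleting vertices does not relabel the
-- others. In constructive terms a finite graph has decidable adjacency.

record Graph (n : ℕ) : Set₁ where
  field
    V          : Subset n
    Adj        : Rel (Fin n) 0ℓ
    Adj?       : Decidable Adj
    Adj-sym    : Symmetric Adj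
    Adj-irrefl : Irreflexive _≡_ Adj
    Adj⇒∈V     : ∀ {u v} → Adj u v → u ∈ V

open Graph public

private
  variable
    m n : ℕ

infixl 8 _[_] _−_

_[_] : Graph n → Subset n → Graph n
G [ S ] = record
  { V          = V G ∩ S
  ; Adj        = λ u v → Adj G u v × u ∈ S × v ∈ S
  ; Adj?       = λ u v → Adj? G u v ×-dec ((u ∈? S) ×-dec (v ∈? S))
  ; Adj-sym    = λ (uv , u∈S , v∈S) → Adj-sym G uv , v∈S , u∈S
  ; Adj-irrefl = λ u≡v (uv , _) → Adj-irrefl G u≡v uv
  ; Adj⇒∈V     = λ (uv , u∈S , _) → x∈p∩q⁺ (Adj⇒∈V G uv , u∈S)
  }

_−_ : Graph n → Subset n → Graph n
G − X = G [ ∁ X ]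

path : ∀ n → Graph n
path n = record
  { V          = ⊤
  ; Adj        = λ i j → ℕ.suc (toℕ i) ≡ toℕ j ⊎ ℕ.suc (toℕ j) ≡ toℕ i
  ; Adj?       = λ i j → (ℕ.suc (toℕ i) ℕ.≟ toℕ j) ⊎-dec (ℕ.suc (toℕ j) ℕ.≟ toℕ i)
  ; Adj-sym    = swap
  ; Adj-irrefl = λ { refl → [ 1+n≢n , 1+n≢n ] }
  ; Adj⇒∈V     = λ _ → ∈⊤
  }

Vertex : Graph n → Set
Vertex G = ∃ λ v → v ∈ V G

infix 4 _≅_ _SpanningSubgraphOf_

record _≅_ (G : Graph m) (H : Graph n) : Set where
  field
    vertices : Vertex G ↔ Vertex H
    adjacent : ∀ (u v : Vertex G) →
               Adj G (proj₁ u) (proj₁ v) ⇔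
               Adj H (proj₁ (Inverse.to vertices u)) (proj₁ (Inverse.to vertices v))

record _SpanningSubgraphOf_ (H G : Graph n) : Set where
  field
    sameVertices : V H ≡ V G
    adjacent     : Adj H ⇒ Adj G

Connected : (G : Graph n) → Rel (Fin n) 0ℓ
Connected G = Star (Adj G)

-- Connectedness is decidable by Warshall's algorithm: Via R ws u v says that
-- v can be reached from u with all intermediate points in ws.

module _ {R : Rel (Fin n) 0ℓ} where

  Via : List (Fin n) → Rel (Fin n) 0ℓ
  Via []       u v = u ≡ v ⊎ R u v
  Via (w ∷ ws) u v = Via ws u v ⊎ (Via ws u w × Via ws w v)

  via? : Decidable R → ∀ ws → Decidable (Via ws)
  via? R? []       u v = (u ≟ᶠ v) ⊎-dec R? u v
  via? R? (w ∷ ws) u v = via? R? ws u v ⊎-dec (via? R? ws u w ×-dec via? R? ws w v)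

  via-sound : ∀ ws {u v} → Via ws u v → Star R u v
  via-sound []       (inj₁ refl)    = ε
  via-sound []       (inj₂ r)       = r ◅ ε
  via-sound (w ∷ ws) (inj₁ p)       = via-sound ws p
  via-sound (w ∷ ws) (inj₂ (p , q)) = via-sound ws p ◅◅ via-sound ws q

  via-base : ∀ ws {u v} → Via [] u v → Via ws u v
  via-base []       p = p
  via-base (w ∷ ws) p = inj₁ (via-base ws p)

  via-trans : ∀ ws {u w v} → w ∈ˡ ws → Via ws u w → Via ws w v → Via ws u v
  via-trans (w ∷ ws) (here refl) p q = inj₂ ([ id , proj₁ ] p , [ id , proj₂ ] q)
  via-trans (y ∷ ws) (there w∈) (inj₁ p)       (inj₁ q)       = inj₁ (via-trans ws w∈ p q)
  via-trans (y ∷ ws) (there w∈) (inj₁ p)       (inj₂ (q , r)) = inj₂ (via-trans ws w∈ p q , r)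
  via-trans (y ∷ ws) (there w∈) (inj₂ (p , q)) (inj₁ r)       = inj₂ (p , via-trans ws w∈ q r)
  via-trans (y ∷ ws) (there w∈) (inj₂ (p , _)) (inj₂ (_ , r)) = inj₂ (p , r)

  via-complete : ∀ {u v} → Star R u v → Via (allFin n) u v
  via-complete ε        = via-base (allFin n) (inj₁ refl)
  via-complete (r ◅ rs) =
    via-trans (allFin n) (∈-allFin _) (via-base (allFin n) (inj₂ r)) (via-complete rs)

connected? : (G : Graph n) → Decidable (Connected G)
connected? {n} G u v = map′ (via-sound (allFin n)) via-complete (via? (Adj? G) (allFin n) u v)

componentOf : (G : Graph n) → Fin n → Subset n
componentOf G v = tabulate (λ w → does (connected? G v w))

_≟ˢ_ : DecidableEquality (Subset n)
_≟ˢ_ = ≡-dec _≟ᵇ_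

-- The vertex sets of the connected components, each listed once.
components : Graph n → List (Subset n)
components {n} G = deduplicate _≟ˢ_ (map (componentOf G) (filter (_∈? V G) (allFin n)))

c : ℕ → Graph n → ℕ
c j H = length (filter (λ C → ∣ C ∣ ℕ.≟ j) (components H))

-- A family of graphs is a predicate on graphs of arbitrary order.
Factor : Pred (Σ ℕ Graph) (suc 0ℓ) → Graph n → Set₁
Factor {n} ℱ G = Σ (Graph n) λ H → H SpanningSubgraphOf G ×
  (∀ {C} → C ∈ˡ components H → ∃ λ m → Σ (Graph m) λ F → ℱ (m , F) × H [ C ] ≅ F)

6k²≢0 : ∀ {k} → 3 ≤ k → NonZero (6 * k ^ 2)
6k²≢0 {ℕ.suc k} _ = m*n≢0 6 (ℕ.suc k ^ 2) {{_}} {{m^n≢0 (ℕ.suc k) 2}}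

-- Starting from W = V, delete from W a vertex covered by every maximum matching
-- of G [ W ] as long as there is one. At the end the components of G [ W ] are
-- factor-critical by Gallai's lemma, and the deleted set S is matched into
-- distinct components. In each component take an alternating path from its
-- exposed vertex until it has 2k+1 vertices or cannot be extended. If it is stuck,
-- it has at most 2k vertices, and its end has no neighbour in W off the path.
-- By an alternating search as in Hall's theorem, either S can be matched so that
-- every unmatched component contains a long path, and these paths together with
-- matching edges form the factor; or some t > 0 components with stuck paths have
-- at most t neighbours in S. Deleting these neighbours and all of the stuck paths
-- but their ends removes at most 2kt vertices and isolates t vertices, which is
-- impossible because 2k · 5/(6k²) < 1.

module Submission where

open import Level as Level using (0ℓ)
open import Defs
open import Data.Bool using (true; if_then_else_; _∨_)
open import Data.Empty using (⊥-elim) renaming (⊥ to False)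
open import Data.Fin using (Fin; zero; suc; toℕ)
open import Data.Fin.Properties using (any?; all?; _≟_; toℕ-injective)
open import Data.Fin.Subset
  using (Subset; inside; outside; _∈_; _∉_; _⊆_; ∣_∣; _∩_; ⁅_⁆; ⊥; _-_) renaming (_∪_ to _∪ˢ_)
open import Data.Fin.Subset.Properties
open import Data.List
  using (List; []; _∷_; length; filter; allFin; map; sum; upTo; lookup; concatMap; _++_; foldr; head; drop)
open import Data.List.Membership.Propositional using (find; lose) renaming (_∈_ to _∈ˡ_; _∉_ to _∉ˡ_)
open import Data.List.Membership.Propositional.Properties
open import Data.List.Properties using (length-++; length-map; length-tabulate)
open import Data.List.Relation.Binary.Subset.Propositional using () renaming (_⊆_ to _⊆ˡ_)
open import Data.List.Relation.Unary.All as All using ([]; _∷_)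
open import Data.List.Relation.Unary.All.Properties using (¬Any⇒All¬)
open import Data.List.Relation.Unary.Any as Any using (here; there; index)
open import Data.List.Relation.Unary.Any.Properties using (lookup-index)
open import Data.List.Relation.Unary.AllPairs using ([]; _∷_)
open import Data.List.Relation.Unary.Unique.Propositional using (Unique)
open import Data.List.Relation.Unary.Unique.Propositional.Properties using (filter⁺; allFin⁺)
open import Data.Maybe using (fromMaybe)
open import Data.Nat as ℕ using (ℕ; zero; suc; _+_; _*_; _^_; _∸_; _<_; z≤n; s≤s; _<?_) renaming (_≤_ to _≤ⁿ_)
open import Data.Nat.Induction using (<-wellFounded)
open import Data.Nat.Properties as ℕₚ
  using (≤-refl; ≤-trans; ≤-antisym; <⇒≱; ≰⇒>; ≮⇒≥; <-irrefl; <-asym; <-cmp; module ≤-Reasoning)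
open import Data.Nat.Tactic.RingSolver using (solve-∀)
open import Data.Product using (Σ; ∃; _×_; _,_; proj₁; proj₂)
open import Data.Integer as ℤ using (+_)
import Data.Integer.Properties as ℤₚ
import Data.Rational.Properties as ℚₚ
open import Data.Rational.Unnormalised using (mkℚᵘ) renaming (_≤_ to _≤ᵘ_; _*_ to _*ᵘ_)
import Data.Rational.Unnormalised.Properties as ℚᵘₚ
open import Data.Rational using (_/_; _≤_) renaming (_*_ to _*ℚ_)
open import Data.Sum as Sum using (_⊎_; inj₁; inj₂; [_,_])
open import Data.Vec using ([]; _∷_; there)
open import Data.Vec.Properties using (lookup∘tabulate; lookup⇒[]=; []=⇒lookup)
open import Data.Vec.Properties.WithK using ([]=-irrelevant)
open import Data.Vec.Functional as F using ()
open import Function.Base using (_∘_; id; case_of_)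
open import Function.Bundles using (mk⇔; mk↔ₛ′)
open import Induction.WellFounded using (Acc; acc)
open import Relation.Binary.Construct.Closure.ReflexiveTransitive using (Star; ε; _◅_; _◅◅_; reverse)
open import Relation.Binary.Definitions using (tri<; tri≈; tri>)
open import Relation.Binary.PropositionalEquality
  using (_≡_; _≢_; _≗_; refl; sym; trans; cong; subst; subst₂)
open import Relation.Nullary using (¬_; Dec; yes; no; ¬?; contradiction)
open import Relation.Nullary.Decidable
  using (map′; _×-dec_; _⊎-dec_; _→-dec_; does; decidable-stable; dec-true)
open import Relation.Unary using (Pred; Decidable; _∪_; ｛_｝)


private
  variable
    n : ℕ

-- Finite search, and counting by duplicate-free lists.

infix 4 _∈ˡ?_

_∈ˡ?_ : (x : Fin n) (xs : List (Fin n)) → Dec (x ∈ˡ xs)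
x ∈ˡ? xs = Any.any? (x ≟_) xs

-- Every extremal choice below is run as a descent in a natural-number measure. With an empty `Done`
-- it becomes a proof by contradiction.
descend : {A : Set} {Done : A → Set} (μ : A → ℕ) →
          (∀ a → Done a ⊎ ∃ λ b → μ b < μ a) → A → ∃ Done
descend {A} {Done} μ step a = go a (<-wellFounded (μ a))
  where
  go : ∀ a → Acc _<_ (μ a) → ∃ Done
  go a (acc rs) with step a
  ... | inj₁ done      = a , done
  ... | inj₂ (b , b<a) = go b (rs b<a)

choose : {A : Fin n → Set} {C : Set} {B : Fin n → C → Set} → Decidable A → (Fin n → C) →
         (∀ x → A x → ∃ (B x)) → ∃ λ (g : Fin n → C) → ∀ x → A x → B x (g x)
choose {A = A} {C} {B} A? c₀ h = (λ x → proj₁ (pick x)) , λ x → proj₂ (pick x)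
  where
  pick : ∀ x → Σ C λ y → A x → B x y
  pick x with A? x
  ... | yes a = proj₁ (h x a) , λ _ → proj₂ (h x a)
  ... | no ¬a = c₀ x , λ a → contradiction a ¬a

-- Functions are searched value by value, which recovers each one only up to pointwise equality;
-- hence the demand that `P` respect `≗`. This makes questions about the existence of matchings
-- decidable.
anyFunction? : ∀ m {P : (Fin m → Fin n) → Set} → (∀ {f g} → f ≗ g → P f → P g) →
               Decidable P → Dec (∃ P)
anyFunction? zero resp P? =
  map′ (_ ,_) (λ (_ , p) → resp (λ ()) p) (P? F.[])
anyFunction? (suc m) resp P? =
  map′ (λ (x , f , p) → (x F.∷ f) , p)
       (λ (f , p) → F.head f , F.tail f , resp (λ { zero → refl ; (suc _) → refl }) p)
       (any? λ x → anyFunction? m (λ f≗g → resp λ { zero → refl ; (suc i) → f≗g i })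
                                  (λ f → P? (x F.∷ f)))

unique-⊆-length : {A : Set} {xs ys : List A} → Unique xs → xs ⊆ˡ ys → length xs ≤ⁿ length ys
unique-⊆-length {xs = []} _ _ = z≤n
unique-⊆-length {xs = x ∷ xs} (x∉ ∷ u) sub with ∈-∃++ (sub (here refl))
... | as , bs , refl = begin
  suc (length xs)             ≤⟨ s≤s (unique-⊆-length u sub′) ⟩
  suc (length (as ++ bs))     ≡⟨ cong suc (length-++ as) ⟩
  suc (length as + length bs) ≡⟨ ℕₚ.+-suc (length as) (length bs) ⟨
  length as + suc (length bs) ≡⟨ length-++ as ⟨
  length (as ++ x ∷ bs)       ∎
  where
  open ≤-Reasoning
  sub′ : xs ⊆ˡ as ++ bs
  sub′ y∈ with ∈-++⁻ as (sub (there y∈))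
  ... | inj₁ p           = ∈-++⁺ˡ p
  ... | inj₂ (here refl) = contradiction refl (All.lookup x∉ y∈)
  ... | inj₂ (there p)   = ∈-++⁺ʳ as p

unique-∷ : {A : Set} {x : A} {xs : List A} → x ∉ˡ xs → Unique xs → Unique (x ∷ xs)
unique-∷ x∉ u = ¬Any⇒All¬ _ x∉ ∷ u

elements : {P : Fin n → Set} → Decidable P → List (Fin n)
elements {n} P? = filter P? (allFin n)

# : {P : Fin n → Set} → Decidable P → ℕ
# P? = length (elements P?)

module _ {P : Fin n → Set} (P? : Decidable P) where

  elements-unique : Unique (elements P?)
  elements-unique = filter⁺ P? (allFin⁺ n)

  elements⁺ : ∀ {x} → P x → x ∈ˡ elements P?
  elements⁺ = ∈-filter⁺ P? (∈-allFin _)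

  elements⁻ : ∀ {x} → x ∈ˡ elements P? → P x
  elements⁻ x∈ = proj₂ (∈-filter⁻ P? {xs = allFin n} x∈)

  unique-length≤# : ∀ {xs} → Unique xs → (∀ {x} → x ∈ˡ xs → P x) → length xs ≤ⁿ # P?
  unique-length≤# u sub = unique-⊆-length u (λ x∈ → elements⁺ (sub x∈))

  #≤length : ∀ {ys} → (∀ {x} → P x → x ∈ˡ ys) → # P? ≤ⁿ length ys
  #≤length sub = unique-⊆-length elements-unique (λ x∈ → sub (elements⁻ x∈))

unique-length≤n : {xs : List (Fin n)} → Unique xs → length xs ≤ⁿ n
unique-length≤n {n} u = ≤-trans (unique-⊆-length u (λ _ → ∈-allFin _))
                            (ℕₚ.≤-reflexive (length-tabulate id))

module _ {P Q : Fin n → Set} (P? : Decidable P) (Q? : Decidable Q) (P⊆Q : ∀ {x} → P x → Q x) where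

  #-mono : # P? ≤ⁿ # Q?
  #-mono = unique-length≤# Q? (elements-unique P?) (P⊆Q ∘ elements⁻ P?)

  #-mono-< : ∀ {x} → ¬ P x → Q x → # P? < # Q?
  #-mono-< ¬p q = unique-length≤# Q? (unique-∷ (¬p ∘ elements⁻ P?) (elements-unique P?))
    λ { (here refl) → q ; (there y∈) → P⊆Q (elements⁻ P? y∈) }

  #-mono-2+ : ∀ {x y} → x ≢ y → ¬ P x → ¬ P y → Q x → Q y → 2 + # P? ≤ⁿ # Q?
  #-mono-2+ x≢y ¬px ¬py qx qy = unique-length≤# Q?
    (unique-∷ (λ { (here x≡y) → x≢y x≡y ; (there x∈) → ¬px (elements⁻ P? x∈) })
      (unique-∷ (¬py ∘ elements⁻ P?) (elements-unique P?)))
    λ { (here refl) → qx ; (there (here refl)) → qy ; (there (there z∈)) → P⊆Q (elements⁻ P? z∈) }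

unique-map : {A B : Set} {f : A → B} {xs : List A} → Unique xs →
             (∀ {x y} → x ∈ˡ xs → y ∈ˡ xs → f x ≡ f y → x ≡ y) → Unique (map f xs)
unique-map {xs = []} _ _ = []
unique-map {f = f} {xs = x ∷ xs} (x∉ ∷ u) inj = unique-∷
  (λ fx∈ → let y , y∈ , e = ∈-map⁻ f fx∈ in All.lookup x∉ y∈ (inj (here refl) (there y∈) e))
  (unique-map u λ x∈ y∈ → inj (there x∈) (there y∈))

length-concatMap : {A B : Set} (f : A → List B) (xs : List A) {l : ℕ} →
                   (∀ {x} → x ∈ˡ xs → length (f x) ≤ⁿ l) → length (concatMap f xs) ≤ⁿ length xs * l
length-concatMap f []       h = z≤n
length-concatMap f (x ∷ xs) h = ≤-trans (ℕₚ.≤-reflexive (length-++ (f x)))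
  (ℕₚ.+-mono-≤ (h (here refl)) (length-concatMap f xs (h ∘ there)))

∣p∪q∣≤∣p∣+∣q∣ : (p q : Subset n) → ∣ p ∪ˢ q ∣ ≤ⁿ ∣ p ∣ + ∣ q ∣
∣p∪q∣≤∣p∣+∣q∣ []            []            = z≤n
∣p∪q∣≤∣p∣+∣q∣ (inside ∷ p)  (t ∷ q)       = s≤s (≤-trans (∣p∪q∣≤∣p∣+∣q∣ p q) (ℕₚ.+-monoʳ-≤ ∣ p ∣ (∣p∣≤∣x∷p∣ t q)))
∣p∪q∣≤∣p∣+∣q∣ (outside ∷ p) (inside ∷ q)  =
  ≤-trans (s≤s (∣p∪q∣≤∣p∣+∣q∣ p q)) (ℕₚ.≤-reflexive (sym (ℕₚ.+-suc ∣ p ∣ ∣ q ∣)))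
∣p∪q∣≤∣p∣+∣q∣ (outside ∷ p) (outside ∷ q) = ∣p∪q∣≤∣p∣+∣q∣ p q

fromList : List (Fin n) → Subset n
fromList = foldr (λ x p → ⁅ x ⁆ ∪ˢ p) ⊥

∈-fromList⁺ : ∀ {xs} {x : Fin n} → x ∈ˡ xs → x ∈ fromList xs
∈-fromList⁺ {x = x} (here refl) = x∈p∪q⁺ (inj₁ (x∈⁅x⁆ x))
∈-fromList⁺ (there x∈)  = x∈p∪q⁺ (inj₂ (∈-fromList⁺ x∈))

∈-fromList⁻ : ∀ xs {x : Fin n} → x ∈ fromList xs → x ∈ˡ xs
∈-fromList⁻ []       x∈ = ⊥-elim (∉⊥ x∈)
∈-fromList⁻ (y ∷ xs) x∈ = [ here ∘ x∈⁅y⁆⇒x≡y y , there ∘ ∈-fromList⁻ xs ] (x∈p∪q⁻ ⁅ y ⁆ (fromList xs) x∈)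

∣fromList∣≤length : (xs : List (Fin n)) → ∣ fromList xs ∣ ≤ⁿ length xs
∣fromList∣≤length {n} [] = ℕₚ.≤-reflexive (∣⊥∣≡0 n)
∣fromList∣≤length (x ∷ xs) = ≤-trans (∣p∪q∣≤∣p∣+∣q∣ ⁅ x ⁆ (fromList xs))
  (ℕₚ.+-mono-≤ (ℕₚ.≤-reflexive (∣⁅x⁆∣≡1 x)) (∣fromList∣≤length xs))

-- Matchings and their change by one edge.

-- A matching is encoded as an involution whose fixed points are the exposed vertices.
module _ (G : Graph n) where

  record Matching (W : Subset n) (M : Fin n → Fin n) : Set where
    constructor matching
    field
      involutive : ∀ v → M (M v) ≡ v
      edge       : ∀ v → M v ≢ v → Adj G v (M v)
      within     : ∀ v → M v ≢ v → v ∈ W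

  matching? : ∀ W → Decidable (Matching W)
  matching? W M = map′ (λ (i , e , w) → matching i e w)
                       (λ (matching i e w) → i , e , w)
    (all? (λ v → M (M v) ≟ v) ×-dec
     all? (λ v → ¬? (M v ≟ v) →-dec Adj? G v (M v)) ×-dec
     all? (λ v → ¬? (M v ≟ v) →-dec (v ∈? W)))

  matching-resp : ∀ {W M N} → M ≗ N → Matching W M → Matching W N
  matching-resp {W} {M} {N} e (matching i a w) = matching
    (λ v → trans (sym (trans (e (M v)) (cong N (e v)))) (i v))
    (λ v ≢ → subst (Adj G v) (e v) (a v (≢ ∘ trans (sym (e v)))))
    (λ v ≢ → w v (≢ ∘ trans (sym (e v))))

module _ {G : Graph n} {W : Subset n} {M : Fin n → Fin n} (mat : Matching G W M) where
  open Matching mat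

  mate-injective : ∀ {x y} → M x ≡ M y → x ≡ y
  mate-injective {x} {y} e = trans (sym (involutive x)) (trans (cong M e) (involutive y))

  mate-within : ∀ {v} → M v ≢ v → M v ∈ W
  mate-within {v} ≢ = within (M v) λ e → ≢ (mate-injective e)

covered? : (M : Fin n → Fin n) → Decidable (λ v → M v ≢ v)
covered? M v = ¬? (M v ≟ v)

cov : (Fin n → Fin n) → ℕ
cov M = # (covered? M)

cov-resp : {M N : Fin n → Fin n} → M ≗ N → cov M ≤ⁿ cov N
cov-resp {M = M} {N} e = #-mono (covered? M) (covered? N) λ {x} ≢ e′ → ≢ (trans (e x) e′)

-- Neither yields an involution for arbitrary arguments: `link` is applied to two exposed vertices,
-- and `unlink` to a covered vertex and its mate.
link unlink : (M : Fin n → Fin n) → Fin n → Fin n → Fin n → Fin n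
link M x y z = if does (z ≟ x) then y else if does (z ≟ y) then x else M z
unlink M x y z = if does (z ≟ x) ∨ does (z ≟ y) then z else M z

module _ (M : Fin n → Fin n) (x y : Fin n) where

  linkView : ∀ z → (z ≡ x × link M x y z ≡ y) ⊎ (z ≡ y × link M x y z ≡ x) ⊎
                   (z ≢ x × z ≢ y × link M x y z ≡ M z)
  linkView z with z ≟ x | z ≟ y
  ... | yes p | _     = inj₁ (p , refl)
  ... | no p  | yes q = inj₂ (inj₁ (q , refl))
  ... | no p  | no q  = inj₂ (inj₂ (p , q , refl))

  unlinkView : ∀ z → ((z ≡ x ⊎ z ≡ y) × unlink M x y z ≡ z) ⊎
                     (z ≢ x × z ≢ y × unlink M x y z ≡ M z)
  unlinkView z with z ≟ x | z ≟ y
  ... | yes p | _     = inj₁ (inj₁ p , refl)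
  ... | no p  | yes q = inj₁ (inj₂ q , refl)
  ... | no p  | no q  = inj₂ (p , q , refl)

module _ {G : Graph n} {W : Subset n} {M : Fin n → Fin n} (mat : Matching G W M) where
  open Matching mat

  module _ {x y : Fin n} (xy : Adj G x y) (x∈ : x ∈ W) (y∈ : y ∈ W)
           (Mx : M x ≡ x) (My : M y ≡ y) where
    private
      L : Fin n → Fin n
      L = link M x y

      x≢y : x ≢ y
      x≢y e = Adj-irrefl G e xy

    link-left : L x ≡ y
    link-left with linkView M x y x
    ... | inj₁ (_ , e)              = e
    ... | inj₂ (inj₁ (p , _))       = contradiction p x≢y
    ... | inj₂ (inj₂ (p , _))       = contradiction refl p

    link-right : L y ≡ x
    link-right with linkView M x y y
    ... | inj₁ (p , _)              = contradiction (sym p) x≢y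
    ... | inj₂ (inj₁ (_ , e))       = e
    ... | inj₂ (inj₂ (_ , p , _))   = contradiction refl p

    link-other : ∀ {z} → z ≢ x → z ≢ y → L z ≡ M z
    link-other {z} z≢x z≢y with linkView M x y z
    ... | inj₁ (p , _)              = contradiction p z≢x
    ... | inj₂ (inj₁ (p , _))       = contradiction p z≢y
    ... | inj₂ (inj₂ (_ , _ , e))   = e

    link-matching : Matching G W L
    link-matching = matching inv adj ins
      where
      inv : ∀ z → L (L z) ≡ z
      inv z with linkView M x y z
      ... | inj₁ (refl , e)         = trans (cong L e) link-right
      ... | inj₂ (inj₁ (refl , e))  = trans (cong L e) link-left
      ... | inj₂ (inj₂ (p , q , e)) = trans (cong L e) (trans
        (link-other (λ r → p (mate-injective mat (trans r (sym Mx))))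
                    (λ r → q (mate-injective mat (trans r (sym My)))))
        (involutive z))

      adj : ∀ z → L z ≢ z → Adj G z (L z)
      adj z ≢ with linkView M x y z
      ... | inj₁ (refl , e)         = subst (Adj G x) (sym e) xy
      ... | inj₂ (inj₁ (refl , e))  = subst (Adj G y) (sym e) (Adj-sym G xy)
      ... | inj₂ (inj₂ (_ , _ , e)) = subst (Adj G z) (sym e) (edge z (≢ ∘ trans e))

      ins : ∀ z → L z ≢ z → z ∈ W
      ins z ≢ with linkView M x y z
      ... | inj₁ (refl , e)         = x∈
      ... | inj₂ (inj₁ (refl , e))  = y∈
      ... | inj₂ (inj₂ (_ , _ , e)) = within z (≢ ∘ trans e)

    cov-link : 2 + cov M ≤ⁿ cov L
    cov-link = #-mono-2+ (covered? M) (covered? L) mono x≢y (λ ¬p → ¬p Mx) (λ ¬p → ¬p My)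
      (λ e → x≢y (trans (sym e) link-left)) (λ e → x≢y (trans (sym link-right) e))
      where
      mono : ∀ {z} → M z ≢ z → L z ≢ z
      mono {z} ≢ e with linkView M x y z
      ... | inj₁ (refl , _)          = ≢ Mx
      ... | inj₂ (inj₁ (refl , _))   = ≢ My
      ... | inj₂ (inj₂ (_ , _ , e′)) = ≢ (trans (sym e′) e)

  module _ {x : Fin n} (Mx : M x ≢ x) where
    private
      U : Fin n → Fin n
      U = unlink M x (M x)

    unlink-left : U x ≡ x
    unlink-left with unlinkView M x (M x) x
    ... | inj₁ (_ , e)     = e
    ... | inj₂ (p , _ , _) = contradiction refl p

    unlink-right : U (M x) ≡ M x
    unlink-right with unlinkView M x (M x) (M x)
    ... | inj₁ (_ , e)     = e
    ... | inj₂ (_ , p , _) = contradiction refl p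

    unlink-other : ∀ {z} → z ≢ x → z ≢ M x → U z ≡ M z
    unlink-other {z} p q with unlinkView M x (M x) z
    ... | inj₁ (inj₁ r , _) = contradiction r p
    ... | inj₁ (inj₂ r , _) = contradiction r q
    ... | inj₂ (_ , _ , e)  = e

    unlink-exposed : ∀ {z} → M z ≡ z → U z ≡ z
    unlink-exposed {z} Mz with unlinkView M x (M x) z
    ... | inj₁ (_ , e)     = e
    ... | inj₂ (_ , _ , e) = trans e Mz

    unlink-matching : Matching G (W - x) U
    unlink-matching = matching inv adj ins
      where
      inv : ∀ z → U (U z) ≡ z
      inv z with unlinkView M x (M x) z
      ... | inj₁ (_ , e)     = trans (cong U e) e
      ... | inj₂ (p , q , e) = trans (cong U e) (trans
        (unlink-other (λ r → q (trans (sym (involutive z)) (cong M r)))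
                      (λ r → p (mate-injective mat r)))
        (involutive z))

      adj : ∀ z → U z ≢ z → Adj G z (U z)
      adj z ≢ with unlinkView M x (M x) z
      ... | inj₁ (_ , e)     = contradiction e ≢
      ... | inj₂ (_ , _ , e) = subst (Adj G z) (sym e) (edge z (≢ ∘ trans e))

      ins : ∀ z → U z ≢ z → z ∈ W - x
      ins z ≢ with unlinkView M x (M x) z
      ... | inj₁ (_ , e)     = contradiction e ≢
      ... | inj₂ (p , _ , e) = x∈p∧x≢y⇒x∈p-y (within z (≢ ∘ trans e)) p

    cov-unlink : cov M ≡ 2 + cov U
    cov-unlink = ≤-antisym
      (#≤length (covered? M) covered)
      (#-mono-2+ (covered? U) (covered? M) mono (Mx ∘ sym) (λ ¬p → ¬p unlink-left) (λ ¬p → ¬p unlink-right)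
        Mx (λ e → Mx (mate-injective mat e)))
      where
      mono : ∀ {z} → U z ≢ z → M z ≢ z
      mono ≢ e = ≢ (unlink-exposed e)

      covered : ∀ {z} → M z ≢ z → z ∈ˡ x ∷ M x ∷ elements (covered? U)
      covered {z} ≢ with unlinkView M x (M x) z
      ... | inj₁ (inj₁ e , _) = here e
      ... | inj₁ (inj₂ e , _) = there (here e)
      ... | inj₂ (_ , _ , e)  = there (there (elements⁺ (covered? U) (≢ ∘ trans (sym e))))

matching-mono : {G : Graph n} {W W′ : Subset n} {M : Fin n → Fin n} →
                W ⊆ W′ → Matching G W M → Matching G W′ M
matching-mono W⊆ (matching i e w) = matching i e (λ v ≢ → W⊆ (w v ≢))

p-x⊆p : ∀ {p : Subset n} {x} → p - x ⊆ p
p-x⊆p {p = p} {x} = p─q⊆p p ⁅ x ⁆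

-- Matching edges are removed one at a time, each uncovering exactly two vertices.
cov-even : {G : Graph n} {W : Subset n} {M : Fin n → Fin n} → Matching G W M → ∃ λ h → cov M ≡ h + h
cov-even {n} {G} {W} {M} mat = go M mat (<-wellFounded (cov M))
  where
  go : ∀ M → Matching G W M → Acc _<_ (cov M) → ∃ λ h → cov M ≡ h + h
  go M mat (acc rs) with any? (covered? M)
  ... | no none = 0 , ℕₚ.n≤0⇒n≡0 (#≤length (covered? M) {ys = []} λ {v} ≢ → contradiction (v , ≢) none)
  ... | yes (v , ≢) with go (unlink M v (M v)) (matching-mono p-x⊆p (unlink-matching mat ≢))
                           (rs (ℕₚ.≤-trans (s≤s (ℕₚ.n≤1+n _)) (ℕₚ.≤-reflexive (sym (cov-unlink mat ≢)))))
  ... | h , e = suc h , trans (cov-unlink mat ≢)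
                          (trans (cong (λ t → suc (suc t)) e) (cong suc (sym (ℕₚ.+-suc h h))))

-- Gallai's lemma.

module Gallai (G : Graph n) (W : Subset n) (ν : ℕ)
              (bound : ∀ {N} → Matching G W N → cov N ≤ⁿ ν) where

  -- Only one inequality is asked for, since `bound` supplies the other: these are the matchings
  -- covering exactly `ν` vertices.
  Opt : (Fin n → Fin n) → Set
  Opt M = Matching G W M × ν ≤ⁿ cov M

  opt? : Decidable Opt
  opt? M = matching? G W M ×-dec (ν ℕ.≤? cov M)

  opt-resp : ∀ {M N} → M ≗ N → Opt M → Opt N
  opt-resp e (mat , ν≤) = matching-resp G e mat , ≤-trans ν≤ (cov-resp e)

  Missable : Fin n → Set
  Missable v = ∃ λ M → Opt M × M v ≡ v

  missable? : Decidable Missable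
  missable? v = anyFunction? n (λ e (o , Mv) → opt-resp e o , trans (sym (e v)) Mv)
                               (λ M → opt? M ×-dec (M v ≟ v))

  -- When every vertex of W is missable, the classes of this relation are the
  -- components of G [ W ], and Gallai's lemma is its transitivity.
  Sep : Fin n → Fin n → Set
  Sep u v = ∀ {M} → Opt M → M u ≡ u → M v ≡ v → u ≡ v

  sep? : ∀ u v → Dec (Sep u v)
  sep? u v with u ≟ v
  ... | yes u≡v = yes λ _ _ _ → u≡v
  ... | no u≢v  = map′ (λ none o Mu Mv → contradiction (_ , o , Mu , Mv) none)
                       (λ s (M , o , Mu , Mv) → u≢v (s o Mu Mv))
    (¬? (anyFunction? n
      (λ e (o , Mu , Mv) → opt-resp e o , trans (sym (e u)) Mu , trans (sym (e v)) Mv)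
      (λ M → opt? M ×-dec (M u ≟ u) ×-dec (M v ≟ v))))

  sep-refl : ∀ {u} → Sep u u
  sep-refl _ _ _ = refl

  sep-sym : ∀ {u v} → Sep u v → Sep v u
  sep-sym s o Mv Mu = sym (s o Mu Mv)

  -- Were both ends missed, linking them would cover two more vertices than `ν` allows.
  sep-adj : ∀ {u v} → Adj G u v → u ∈ W → v ∈ W → Sep u v
  sep-adj uv u∈ v∈ (mat , ν≤) Mu Mv = contradiction
    (≤-trans (ℕₚ.+-monoʳ-≤ 2 ν≤) (≤-trans (cov-link mat uv u∈ v∈ Mu Mv)
      (bound (link-matching mat uv u∈ v∈ Mu Mv))))
    (<⇒≱ (ℕₚ.m<n+m ν (s≤s z≤n)))

  -- Among the maximum matchings N missing t take one agreeing with M as much as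
  -- possible. Counting gives x ≠ t missed by N but not by M; exchanging the edge
  -- of N at M x for x — M x increases the agreement.
  sep-trans : ∀ {u t v} → Missable t → Sep u t → Sep t v → Sep u v
  sep-trans {u} {t} {v} miss ut tv {M} oM@(matM , ν≤M) Mu Mv = decidable-stable (u ≟ v) λ u≢v →
    proj₂ (descend {Done = λ _ → False} (λ (N , _) → disagreement N) (λ N → inj₂ (improve u≢v N)) miss)
    where
    differ? : ∀ N → Decidable (λ w → M w ≢ N w)
    differ? N w = ¬? (M w ≟ N w)

    disagreement : (Fin n → Fin n) → ℕ
    disagreement N = # (differ? N)

    improve : u ≢ v → (a : Missable t) →
              ∃ λ (b : Missable t) → disagreement (proj₁ b) < disagreement (proj₁ a)
    improve u≢v (N , oN@(matN , ν≤N) , Nt) with any? (λ x → ¬? (x ≟ t) ×-dec (N x ≟ x) ×-dec covered? M x)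
    -- Here every vertex covered by `M`, except possibly `t`, is covered by `N`. Both `u` and `v`
    -- are missed by `M` and covered by `N`, so two more than the vertices covered by `M` fit into
    -- one more than those covered by `N`, although `M` covers at least `ν` and `N` at most `ν`.
    ... | no none = contradiction
        (≤-trans (s≤s (s≤s ν≤M)) (≤-trans
          (unique-⊆-length
            (unique-∷ (λ { (here e) → u≢v e ; (there u∈) → elements⁻ (covered? M) u∈ Mu })
              (unique-∷ (λ v∈ → elements⁻ (covered? M) v∈ Mv) (elements-unique (covered? M))))
            sub)
          (s≤s (bound matN))))
        (<⇒≱ ≤-refl)
      where
      -- If `M` missed `t` along with `u` and `v`, the two separations would give `u ≡ t ≡ v`.
      Mt : M t ≢ t
      Mt e = u≢v (trans (ut oM Mu e) (tv oM e Mv))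

      Nu : N u ≢ u
      Nu e = Mt (subst (λ w → M w ≡ w) (ut oN e Nt) Mu)

      Nv : N v ≢ v
      Nv e = Mt (subst (λ w → M w ≡ w) (sym (tv oN Nt e)) Mv)

      sub : ∀ {w} → w ∈ˡ u ∷ v ∷ elements (covered? M) → w ∈ˡ t ∷ elements (covered? N)
      sub (here refl)         = there (elements⁺ (covered? N) Nu)
      sub (there (here refl)) = there (elements⁺ (covered? N) Nv)
      sub {w} (there (there w∈)) with w ≟ t
      ... | yes e = here e
      ... | no w≢t = there (elements⁺ (covered? N) λ Nw → none (w , w≢t , Nw , elements⁻ (covered? M) w∈))
    ... | yes (x , x≢t , Nx , Mx) = (N′ , (matN′ , ν≤N′) , N′t) , closer
      where
      y : Fin n
      y = M x

      xy : Adj G x y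
      xy = Matching.edge matM x Mx

      x∈ : x ∈ W
      x∈ = Matching.within matM x Mx

      y∈ : y ∈ W
      y∈ = mate-within matM Mx

      Ny : N y ≢ y
      Ny e = Mx (sym (sep-adj xy x∈ y∈ oN Nx e))

      U N′ : Fin n → Fin n
      U = unlink N y (N y)
      N′ = link U x y

      matU : Matching G W U
      matU = matching-mono p-x⊆p (unlink-matching matN Ny)

      Ux : U x ≡ x
      Ux = unlink-exposed matN Ny Nx

      Uy : U y ≡ y
      Uy = unlink-left matN Ny

      matN′ : Matching G W N′
      matN′ = link-matching matU xy x∈ y∈ Ux Uy

      ν≤N′ : ν ≤ⁿ cov N′
      ν≤N′ = ≤-trans ν≤N (≤-trans (ℕₚ.≤-reflexive (cov-unlink matN Ny)) (cov-link matU xy x∈ y∈ Ux Uy))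

      N′t : N′ t ≡ t
      N′t = trans (link-other matU xy x∈ y∈ Ux Uy (x≢t ∘ sym) (λ { refl → Ny Nt }))
                  (unlink-exposed matN Ny Nt)

      Ny≢x : N y ≢ x
      Ny≢x e = Ny (trans (trans e (sym Nx)) (trans (cong N (sym e)) (Matching.involutive matN y)))

      -- No agreement is lost: the mate changes only at `x`, `y` and `N y`, and there `M` and `N`
      -- already differ.
      mono : ∀ {w} → M w ≢ N′ w → M w ≢ N w
      mono {w} d e with linkView U x y w
      ... | inj₁ (refl , _) = Mx (trans e Nx)
      ... | inj₂ (inj₁ (refl , _)) = Ny≢x (trans (sym e) (Matching.involutive matM x))
      ... | inj₂ (inj₂ (p , q , N′w)) with unlinkView N y (N y) w
      ...   | inj₁ (inj₁ r , _) = q r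
      ...   | inj₁ (inj₂ refl , _) = Ny≢x (mate-injective matM (trans e (Matching.involutive matN y)))
      ...   | inj₂ (_ , _ , Uw) = d (trans e (sym (trans N′w Uw)))

      closer : disagreement N′ < disagreement N
      closer = #-mono-< (differ? N′) (differ? N) mono {x}
        (λ d → d (sym (link-left matU xy x∈ y∈ Ux Uy))) (λ e → Mx (trans e Nx))

-- Maximum matchings and barriers.

x∉p-x : ∀ {p : Subset n} {x} → x ∉ p - x
x∉p-x {p = _ ∷ _} {suc x} (there x∈) = x∉p-x x∈

Maximum : Graph n → Subset n → (Fin n → Fin n) → Set
Maximum G W M = ∀ {N} → Matching G W N → cov N ≤ⁿ cov M

maximumMatching : (G : Graph n) (W : Subset n) → ∃ λ M → Matching G W M × Maximum G W M
maximumMatching {n} G W =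
  let (M , mat) , max = descend {Done = Maximum G W ∘ proj₁} (λ (M , _) → n ∸ cov M) step start
  in M , mat , max
  where
  start : ∃ (Matching G W)
  start = id , matching (λ _ → refl) (λ _ ≢ → contradiction refl ≢) (λ _ ≢ → contradiction refl ≢)

  step : (a : ∃ (Matching G W)) →
         Maximum G W (proj₁ a) ⊎ ∃ λ (b : ∃ (Matching G W)) → n ∸ cov (proj₁ b) < n ∸ cov (proj₁ a)
  step (M , mat) with anyFunction? n {P = λ N → Matching G W N × cov M < cov N}
                        (λ e (mat , c<) → matching-resp G e mat , ≤-trans c< (cov-resp e))
                        (λ N → matching? G W N ×-dec (cov M <? cov N))
  ... | yes (N , mat , c<) = inj₂ ((N , mat) , ℕₚ.∸-monoʳ-< c< (unique-length≤n (elements-unique (covered? N))))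
  ... | no none = inj₁ λ {N} mat → ≮⇒≥ λ c< → none (N , mat , c<)

-- The deleted set S = V ∖ W is a barrier: φ matches it into the vertices exposed by M.
record Barrier (G : Graph n) : Set where
  field
    W           : Subset n
    M           : Fin n → Fin n
    φ           : Fin n → Fin n
    W⊆V         : W ⊆ V G
    M-matching  : Matching G W M
    M-maximum   : Maximum G W M

  Deleted : Fin n → Set
  Deleted s = s ∈ V G × s ∉ W

  deleted? : Decidable Deleted
  deleted? s = (s ∈? V G) ×-dec ¬? (s ∈? W)

  Exposed : Fin n → Set
  Exposed u = u ∈ W × M u ≡ u

  exposed? : Decidable Exposed
  exposed? u = (u ∈? W) ×-dec (M u ≟ u)

  field
    φ-exposed   : ∀ {s} → Deleted s → Exposed (φ s)
    φ-adjacent  : ∀ {s} → Deleted s → Adj G s (φ s)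
    φ-injective : ∀ {s s′} → Deleted s → Deleted s′ → φ s ≡ φ s′ → s ≡ s′

  open Gallai G W (cov M) M-maximum public

module _ {G : Graph n} where

  open Barrier

  trivialBarrier : Barrier G
  trivialBarrier = let M , mat , max = maximumMatching G (V G) in record
    { W = V G ; M = M ; φ = id ; W⊆V = id ; M-matching = mat ; M-maximum = max
    ; φ-exposed   = λ (s∈ , s∉) → contradiction s∈ s∉
    ; φ-adjacent  = λ (s∈ , s∉) → contradiction s∈ s∉
    ; φ-injective = λ (s∈ , s∉) → contradiction s∈ s∉
    }

  -- Since `M` cannot miss `v`, moving `v` to the deleted set breaks the edge from `v` to `M v`. Its
  -- other end becomes exposed and serves as the partner of `v`; it differs from all earlier
  -- partners, which `M` already missed.
  extendBarrier : (B : Barrier G) → ∀ {v} → v ∈ W B → ¬ Missable B v →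
                  ∃ λ B′ → ∣ W B′ ∣ < ∣ W B ∣
  extendBarrier B {v} v∈ unmissable = record
    { W = W B - v ; M = U ; φ = φ′ ; W⊆V = W⊆V B ∘ p-x⊆p
    ; M-matching = unlink-matching mat Mv
    ; M-maximum = U-maximum
    ; φ-exposed = φ′-exposed ; φ-adjacent = φ′-adjacent ; φ-injective = φ′-injective
    } , x∈p⇒∣p-x∣<∣p∣ v∈
    where
    mat : Matching G (W B) (M B)
    mat = M-matching B

    Mv : M B v ≢ v
    Mv e = unmissable (M B , (mat , ≤-refl) , e)

    U : Fin n → Fin n
    U = unlink (M B) v (M B v)

    -- A larger matching avoiding v would, by parity, be a maximum matching missing v.
    U-maximum : Maximum G (W B - v) U
    U-maximum {N} matN = ≮⇒≥ λ U<N → unmissable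
      (N , (matN′ , covM≤ U<N) , decidable-stable (N v ≟ v) (λ Nv → x∉p-x (Matching.within matN v Nv)))
      where
      matN′ : Matching G (W B) N
      matN′ = matching-mono p-x⊆p matN

      covM≤ : cov U < cov N → cov (M B) ≤ⁿ cov N
      covM≤ U<N with cov-even (unlink-matching mat Mv) | cov-even matN
      ... | h , eU | g , eN = subst₂ _≤ⁿ_
        (sym (trans (cov-unlink mat Mv)
          (trans (cong (λ t → suc (suc t)) eU) (cong suc (sym (ℕₚ.+-suc h h))))))
        (sym eN) (ℕₚ.+-mono-≤ h<g h<g)
        where
        h<g : h < g
        h<g = ≰⇒> λ g≤h → <⇒≱ (subst₂ _<_ eU eN U<N) (ℕₚ.+-mono-≤ g≤h g≤h)

    φ′ : Fin n → Fin n
    φ′ s = if does (s ≟ v) then M B v else φ B s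

    φ′-view : ∀ {s} → s ∈ V G × s ∉ W B - v →
              (s ≡ v × φ′ s ≡ M B v) ⊎ (Deleted B s × φ′ s ≡ φ B s)
    φ′-view {s} (s∈ , s∉) with s ≟ v
    ... | yes e = inj₁ (e , refl)
    ... | no s≢v = inj₂ ((s∈ , λ s∈W → s∉ (x∈p∧x≢y⇒x∈p-y s∈W s≢v)) , refl)

    φ′-exposed : ∀ {s} → s ∈ V G × s ∉ W B - v → φ′ s ∈ W B - v × U (φ′ s) ≡ φ′ s
    φ′-exposed del with φ′-view del
    ... | inj₁ (refl , e) = subst (λ w → w ∈ W B - v × U w ≡ w) (sym e)
            (x∈p∧x≢y⇒x∈p-y (mate-within mat Mv) Mv , unlink-right mat Mv)
    ... | inj₂ (del′ , e) = let φ∈ , Mφ = φ-exposed B del′ in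
            subst (λ w → w ∈ W B - v × U w ≡ w) (sym e)
            (x∈p∧x≢y⇒x∈p-y φ∈ (λ { refl → Mv Mφ }) , unlink-exposed mat Mv Mφ)

    φ′-adjacent : ∀ {s} → s ∈ V G × s ∉ W B - v → Adj G s (φ′ s)
    φ′-adjacent {s} del with φ′-view del
    ... | inj₁ (refl , e) = subst (Adj G s) (sym e) (Matching.edge mat v Mv)
    ... | inj₂ (del′ , e) = subst (Adj G s) (sym e) (φ-adjacent B del′)

    φ≢Mv : ∀ {s} → Deleted B s → φ B s ≢ M B v
    φ≢Mv del e = Mv (mate-injective mat (trans (sym (cong (M B) e)) (trans (proj₂ (φ-exposed B del)) e)))

    φ′-injective : ∀ {s s′} → s ∈ V G × s ∉ W B - v → s′ ∈ V G × s′ ∉ W B - v → φ′ s ≡ φ′ s′ → s ≡ s′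
    φ′-injective del del′ e with φ′-view del | φ′-view del′
    ... | inj₁ (refl , _) | inj₁ (refl , _) = refl
    ... | inj₁ (_ , p) | inj₂ (d , q) = contradiction (trans (sym q) (trans (sym e) p)) (φ≢Mv d)
    ... | inj₂ (d , q) | inj₁ (_ , p) = contradiction (trans (sym q) (trans e p)) (φ≢Mv d)
    ... | inj₂ (d , p) | inj₂ (d′ , q) = φ-injective B d d′ (trans (sym p) (trans e q))

-- Missability throughout `W` is what lets `sep-trans` be applied at every middle vertex in `W`.
gallaiBarrier : (G : Graph n) → ∃ λ (B : Barrier G) → ∀ {v} → v ∈ Barrier.W B → Barrier.Missable B v
gallaiBarrier G = descend (λ B → ∣ Barrier.W B ∣) step trivialBarrier
  where
  step : (B : Barrier G) → (∀ {v} → v ∈ Barrier.W B → Barrier.Missable B v) ⊎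
                           ∃ λ B′ → ∣ Barrier.W B′ ∣ < ∣ Barrier.W B ∣
  step B with any? (λ v → (v ∈? Barrier.W B) ×-dec ¬? (Barrier.missable? B v))
  ... | yes (v , v∈ , unmissable) = inj₂ (extendBarrier B v∈ unmissable)
  ... | no none = inj₁ λ {v} v∈ → decidable-stable (Barrier.missable? B v) λ ¬m → none (v , v∈ , ¬m)

-- Alternating search in a bipartite relation.

module Hall {S U Good : Fin n → Set} {E : Fin n → Fin n → Set}
            (S? : Decidable S) (U? : Decidable U) (Good? : Decidable Good) (E? : ∀ s u → Dec (E s u)) where

  record Assignment : Set where
    field
      target    : Fin n → Fin n
      into      : ∀ {s} → S s → U (target s)
      related   : ∀ {s} → S s → E s (target s)
      injective : ∀ {s s′} → S s → S s′ → target s ≡ target s′ → s ≡ s′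

  open Assignment

  Hit : Assignment → Fin n → Set
  Hit a u = ∃ λ s → S s × target a s ≡ u

  hit? : ∀ a → Decidable (Hit a)
  hit? a u = any? λ s → S? s ×-dec (target a s ≟ u)

  Lacking : Assignment → Fin n → Set
  Lacking a u = U u × ¬ Good u × ¬ Hit a u

  lacking? : ∀ a → Decidable (Lacking a)
  lacking? a u = U? u ×-dec ¬? (Good? u) ×-dec ¬? (hit? a u)

  -- The analogue of a Hall violator. By `closed` and injectivity, `members` have at most as many
  -- neighbours in `S` as there are members, while none of them is `Good`.
  record Obstruction : Set where
    field
      members    : List (Fin n)
      unique     : Unique members
      nonempty   : ∃ λ u → u ∈ˡ members
      bad        : ∀ {u} → u ∈ˡ members → U u × ¬ Good u
      assignment : Assignment
      closed     : ∀ {s u} → S s → u ∈ˡ members → E s u → target assignment s ∈ˡ members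

  module _ (a : Assignment) {u₀ : Fin n} (lack : Lacking a u₀) where

    -- Obtained from a by shifting targets along an alternating walk from u₀ to C inside T.
    record Rerouted (T : List (Fin n)) (C : Fin n) : Set where
      field
        rerouted : Assignment
        free     : ¬ Hit rerouted C
        agrees   : ∀ {s} → S s → target a s ∉ˡ T → target rerouted s ≡ target a s
        keeps    : ∀ {u} → Hit a u ⊎ u ≡ u₀ → Hit rerouted u ⊎ u ≡ C

    open Rerouted

    -- `T` holds the vertices of an alternating search tree rooted at `u₀`. Any one of them can be
    -- made the unhit vertex in place of `u₀`.
    record Search : Set where
      field
        T        : List (Fin n)
        distinct : Unique T
        start    : u₀ ∈ˡ T
        bad      : ∀ {u} → u ∈ˡ T → U u × ¬ Good u
        routes   : ∀ {u} → u ∈ˡ T → Rerouted T u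

    open Search

    -- One exchange along the walk: `s` takes over the unhit `C` and releases its own target. That
    -- target lies outside `T`, so by `agrees` the earlier exchanges have left it with `s`.
    reroute : ∀ {T C s} → Rerouted T C → C ∈ˡ T → U C → S s → E s C → target a s ∉ˡ T →
              Rerouted (target a s ∷ T) (target a s)
    reroute {T} {C} {s} r C∈ UC Ss EsC D∉ = record
      { rerouted = b′ ; free = free′ ; agrees = agrees′ ; keeps = keeps′ }
      where
      b : Assignment
      b = rerouted r

      g : Fin n → Fin n
      g z = if does (z ≟ s) then C else target b z

      view : ∀ z → (z ≡ s × g z ≡ C) ⊎ (z ≢ s × g z ≡ target b z)
      view z with z ≟ s
      ... | yes p = inj₁ (p , refl)
      ... | no p  = inj₂ (p , refl)

      g-other : ∀ {z} → z ≢ s → g z ≡ target b z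
      g-other {z} z≢s with view z
      ... | inj₁ (p , _) = contradiction p z≢s
      ... | inj₂ (_ , e) = e

      gs≡C : g s ≡ C
      gs≡C with view s
      ... | inj₁ (_ , e) = e
      ... | inj₂ (p , _) = contradiction refl p

      b′ : Assignment
      b′ = record { target = g ; into = into′ ; related = related′ ; injective = inj′ }
        where
        into′ : ∀ {z} → S z → U (g z)
        into′ {z} Sz with view z
        ... | inj₁ (_ , e) = subst U (sym e) UC
        ... | inj₂ (_ , e) = subst U (sym e) (into b Sz)

        related′ : ∀ {z} → S z → E z (g z)
        related′ {z} Sz with view z
        ... | inj₁ (refl , e) = subst (E z) (sym e) EsC
        ... | inj₂ (_ , e)    = subst (E z) (sym e) (related b Sz)

        inj′ : ∀ {y z} → S y → S z → g y ≡ g z → y ≡ z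
        inj′ {y} {z} Sy Sz e with view y | view z
        ... | inj₁ (p , _) | inj₁ (q , _) = trans p (sym q)
        ... | inj₁ (_ , p) | inj₂ (_ , q) = contradiction (z , Sz , trans (sym q) (trans (sym e) p)) (free r)
        ... | inj₂ (_ , p) | inj₁ (_ , q) = contradiction (y , Sy , trans (sym p) (trans e q)) (free r)
        ... | inj₂ (_ , p) | inj₂ (_ , q) = injective b Sy Sz (trans (sym p) (trans e q))

      bs≡D : target b s ≡ target a s
      bs≡D = agrees r Ss D∉

      free′ : ¬ Hit b′ (target a s)
      free′ (z , Sz , e) with view z
      ... | inj₁ (_ , q) = D∉ (subst (_∈ˡ T) (trans (sym q) e) C∈)
      ... | inj₂ (p , q) = p (injective b Sz Ss (trans (sym q) (trans e (sym bs≡D))))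

      agrees′ : ∀ {z} → S z → target a z ∉ˡ target a s ∷ T → g z ≡ target a z
      agrees′ Sz ∉ = trans (g-other (λ { refl → ∉ (here refl) })) (agrees r Sz (∉ ∘ there))

      keeps′ : ∀ {u} → Hit a u ⊎ u ≡ u₀ → Hit b′ u ⊎ u ≡ target a s
      keeps′ h with keeps r h
      ... | inj₂ refl = inj₁ (s , Ss , gs≡C)
      ... | inj₁ (z , Sz , e) with z ≟ s
      ...   | yes refl = inj₂ (trans (sym e) bs≡D)
      ...   | no z≢s   = inj₁ (z , Sz , trans (g-other z≢s) e)

    Outcome : Set
    Outcome = Obstruction ⊎ ∃ λ b → # (lacking? b) < # (lacking? a)

    -- If no neighbour of `T` has its target outside `T`, then `T` is an obstruction. Otherwise such
    -- a target is reached: a `Good` one may be left unhit so that `u₀` gets hit, which lowers the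
    -- number of lacking vertices; any other one enlarges `T`.
    search-step : (σ : Search) → Outcome ⊎ ∃ λ (σ′ : Search) → n ∸ length (T σ′) < n ∸ length (T σ)
    search-step σ with any? (λ s → any? λ C → S? s ×-dec (C ∈ˡ? T σ) ×-dec E? s C ×-dec ¬? (target a s ∈ˡ? T σ))
    ... | no none = inj₁ (inj₁ (record
      { members = T σ ; unique = distinct σ ; nonempty = u₀ , start σ ; bad = bad σ ; assignment = a
      ; closed = λ {s} {C} Ss C∈ EsC → decidable-stable (target a s ∈ˡ? T σ) λ D∉ → none (s , C , Ss , C∈ , EsC , D∉)
      }))
    ... | yes (s , C , Ss , C∈ , EsC , D∉) with Good? (target a s)
    ...   | yes good = inj₁ (inj₂ (rerouted r , #-mono-< (lacking? (rerouted r)) (lacking? a) mono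
                         (λ (_ , _ , ¬hit) → [ ¬hit , (λ { refl → D∉ (start σ) }) ] (keeps r (inj₂ refl))) lack))
      where
      r : Rerouted (target a s ∷ T σ) (target a s)
      r = reroute (routes σ C∈) C∈ (proj₁ (bad σ C∈)) Ss EsC D∉

      mono : ∀ {u} → Lacking (rerouted r) u → Lacking a u
      mono (Uu , ¬good , ¬hit) = Uu , ¬good , λ h → [ ¬hit , (λ { refl → ¬good good }) ] (keeps r (inj₁ h))
    ...   | no ¬good = inj₂ (σ′ , ℕₚ.∸-monoʳ-< ≤-refl (unique-length≤n (distinct σ′)))
      where
      D : Fin n
      D = target a s

      bad′ : ∀ {u} → u ∈ˡ D ∷ T σ → U u × ¬ Good u
      bad′ (here refl) = into a Ss , ¬good
      bad′ (there u∈)  = bad σ u∈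

      routes′ : ∀ {u} → u ∈ˡ D ∷ T σ → Rerouted (D ∷ T σ) u
      routes′ (here refl) = reroute (routes σ C∈) C∈ (proj₁ (bad σ C∈)) Ss EsC D∉
      routes′ (there u∈)  = let r = routes σ u∈ in record
        { rerouted = rerouted r ; free = free r ; keeps = keeps r
        ; agrees = λ Sz ∉ → agrees r Sz (∉ ∘ there) }

      σ′ : Search
      σ′ = record { T = D ∷ T σ ; distinct = unique-∷ D∉ (distinct σ) ; start = there (start σ)
                  ; bad = bad′ ; routes = routes′ }

    search : Outcome
    search = proj₂ (descend {Done = λ _ → Outcome} (λ σ → n ∸ length (T σ)) search-step record
      { T = u₀ ∷ [] ; distinct = [] ∷ [] ; start = here refl
      ; bad = λ { (here refl) → proj₁ lack , proj₁ (proj₂ lack) }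
      ; routes = λ { (here refl) → record
          { rerouted = a ; free = proj₂ (proj₂ lack) ; agrees = λ _ _ → refl ; keeps = id } }
      })

  saturate : Assignment → (∃ λ a → ∀ {u} → ¬ Lacking a u) ⊎ Obstruction
  saturate a₀ = let a , r = descend {Done = Saturated} (λ a → # (lacking? a)) step a₀
                in Sum.map₁ (λ none → a , λ {u} → none {u}) r
    where
    Saturated : Assignment → Set
    Saturated a = (∀ {u} → ¬ Lacking a u) ⊎ Obstruction

    step : (a : Assignment) → Saturated a ⊎ ∃ λ b → # (lacking? b) < # (lacking? a)
    step a with any? (lacking? a)
    ... | no none         = inj₁ (inj₁ λ {u} l → none (u , l))
    ... | yes (u₀ , lack) = Sum.map₁ inj₂ (search a lack)

-- Path tilings, the factors they give, and isolating sets.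

data Next {A : Set} : List A → A → A → Set where
  here  : ∀ {x y xs} → Next (x ∷ y ∷ xs) x y
  there : ∀ {x xs u v} → Next xs u v → Next (x ∷ xs) u v

next? : ∀ xs (u v : Fin n) → Dec (Next xs u v)
next? []       u v = no λ ()
next? (x ∷ []) u v = no λ { (there ()) }
next? (x ∷ y ∷ xs) u v =
  map′ (λ { (inj₁ (refl , refl)) → here ; (inj₂ p) → there p })
       (λ { here → inj₁ (refl , refl) ; (there p) → inj₂ p })
       (((x ≟ u) ×-dec (y ≟ v)) ⊎-dec next? (y ∷ xs) u v)

module _ {A : Set} where

  next-∈ : {xs : List A} {u v : A} → Next xs u v → u ∈ˡ xs × v ∈ˡ xs
  next-∈ here      = here refl , there (here refl)
  next-∈ (there p) = let u∈ , v∈ = next-∈ p in there u∈ , there v∈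

  next⇒lookup : {xs : List A} {u v : A} → Next xs u v →
                ∃ λ i → ∃ λ j → u ≡ lookup xs i × v ≡ lookup xs j × suc (toℕ i) ≡ toℕ j
  next⇒lookup here      = zero , suc zero , refl , refl , refl
  next⇒lookup (there p) = let i , j , e , e′ , s = next⇒lookup p in suc i , suc j , e , e′ , cong suc s

  lookup⇒next : (xs : List A) (i j : Fin (length xs)) → suc (toℕ i) ≡ toℕ j → Next xs (lookup xs i) (lookup xs j)
  lookup⇒next (x ∷ y ∷ xs) zero    (suc zero) e  = here
  lookup⇒next (x ∷ xs)     (suc i) (suc j)    e  = there (lookup⇒next xs i j (ℕₚ.suc-injective e))

  unique-lookup : {xs : List A} → Unique xs → ∀ i j → lookup xs i ≡ lookup xs j → i ≡ j
  unique-lookup (_ ∷ _) zero zero _ = refl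
  unique-lookup {xs = _ ∷ xs} (x∉ ∷ _) zero (suc j) e = contradiction e (All.lookup x∉ (∈-lookup j))
  unique-lookup {xs = _ ∷ xs} (x∉ ∷ _) (suc i) zero e = contradiction (sym e) (All.lookup x∉ (∈-lookup i))
  unique-lookup (_ ∷ u) (suc i) (suc j) e = cong suc (unique-lookup u i j e)

  next-star : {R : A → A → Set} → ∀ {x y} xs → (∀ {u v} → Next (x ∷ xs) u v → R u v) → y ∈ˡ x ∷ xs → Star R x y
  next-star xs       R (here refl) = ε
  next-star (z ∷ xs) R (there y∈)  = R here ◅ next-star xs (R ∘ there) y∈

module _ (G : Graph n) (v : Fin n) {w : Fin n} where

  ∈-componentOf⁺ : Connected G v w → w ∈ componentOf G v
  ∈-componentOf⁺ c = lookup⇒[]= w _ (trans (lookup∘tabulate _ w) (dec-true (connected? G v w) c))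

  ∈-componentOf⁻ : w ∈ componentOf G v → Connected G v w
  ∈-componentOf⁻ w∈ = holds (connected? G v w) (trans (sym (lookup∘tabulate _ w)) ([]=⇒lookup w∈))
    where
    holds : ∀ {A : Set} (A? : Dec A) → does A? ≡ true → A
    holds (yes a) _ = a

∈-components⁻ : (G : Graph n) {C : Subset n} → C ∈ˡ components G → ∃ λ v → v ∈ V G × C ≡ componentOf G v
∈-components⁻ {n} G C∈ =
  let v , v∈ , e = ∈-map⁻ (componentOf G) (∈-deduplicate⁻ _≟ˢ_ (map (componentOf G) (elements (_∈? V G))) C∈)
  in v , elements⁻ (_∈? V G) v∈ , e

∈-components⁺ : (G : Graph n) {v : Fin n} → v ∈ V G → componentOf G v ∈ˡ components G
∈-components⁺ G v∈ = ∈-deduplicate⁺ _≟ˢ_ (∈-map⁺ (componentOf G) (elements⁺ (_∈? V G) v∈))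

-- The tile of a vertex that is not chosen as the name of a path is empty.
record Tiling (G : Graph n) (Size : ℕ → Set) : Set where
  field
    tile     : Fin n → List (Fin n)
    unique   : ∀ a → Unique (tile a)
    edges    : ∀ a {u v} → Next (tile a) u v → Adj G u v
    disjoint : ∀ {a b x} → x ∈ˡ tile a → x ∈ˡ tile b → a ≡ b
    contained : ∀ {a x} → x ∈ˡ tile a → x ∈ V G
    cover    : ∀ {v} → v ∈ V G → ∃ λ a → v ∈ˡ tile a
    size     : ∀ {a x} → x ∈ˡ tile a → Size (length (tile a))

module _ {G : Graph n} {Size : ℕ → Set} (T : Tiling G Size) where
  open Tiling T

  tilingGraph : Graph n
  tilingGraph = record
    { V = V G
    ; Adj = λ u v → ∃ λ a → Next (tile a) u v ⊎ Next (tile a) v u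
    ; Adj? = λ u v → any? λ a → next? (tile a) u v ⊎-dec next? (tile a) v u
    ; Adj-sym = λ (a , p) → a , Sum.swap p
    ; Adj-irrefl = λ { e (a , inj₁ p) → Adj-irrefl G e (edges a p)
                     ; e (a , inj₂ p) → Adj-irrefl G (sym e) (edges a p) }
    ; Adj⇒∈V = λ (a , p) → [ contained ∘ proj₁ ∘ next-∈ , contained ∘ proj₂ ∘ next-∈ ] p
    }

  -- Each edge lies inside one tile, so by disjointness a walk never changes tile.
  connected-in-tile : ∀ {a x y} → x ∈ˡ tile a → Connected tilingGraph x y → y ∈ˡ tile a
  connected-in-tile x∈ ε = x∈
  connected-in-tile {a} {x} x∈ ((b , p) ◅ s) = connected-in-tile (step p) s
    where
    step : ∀ {y} → Next (tile b) x y ⊎ Next (tile b) y x → y ∈ˡ tile a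
    step (inj₁ p) = let u∈ , v∈ = next-∈ p in subst (λ c → _ ∈ˡ tile c) (disjoint u∈ x∈) v∈
    step (inj₂ p) = let u∈ , v∈ = next-∈ p in subst (λ c → _ ∈ˡ tile c) (disjoint v∈ x∈) u∈

  tile-connected : ∀ {a x y} → x ∈ˡ tile a → y ∈ˡ tile a → Connected tilingGraph x y
  tile-connected {a} x∈ y∈ = go (tile a) (λ p → a , inj₁ p) x∈ y∈
    where
    go : ∀ t → (∀ {u v} → Next t u v → Adj tilingGraph u v) →
         ∀ {x y} → x ∈ˡ t → y ∈ˡ t → Connected tilingGraph x y
    go (z ∷ t) R x∈ y∈ = reverse (Adj-sym tilingGraph) (next-star t R x∈) ◅◅ next-star t R y∈

  module _ {v a} (v∈V : v ∈ V G) (v∈ : v ∈ˡ tile a) where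
    private
      H : Graph n
      H = tilingGraph

      C : Subset n
      C = componentOf H v

      t : List (Fin n)
      t = tile a

      ∈C⇒∈t : ∀ {w} → w ∈ V G ∩ C → w ∈ˡ t
      ∈C⇒∈t w∈ = connected-in-tile v∈ (∈-componentOf⁻ H v (proj₂ (x∈p∩q⁻ (V G) C w∈)))

      ∈t⇒∈C : ∀ {w} → w ∈ˡ t → w ∈ V G ∩ C
      ∈t⇒∈C w∈ = x∈p∩q⁺ (contained w∈ , ∈-componentOf⁺ H v (tile-connected v∈ w∈))

      vertex-≡ : ∀ {m} {F : Graph m} {u v : Vertex F} → proj₁ u ≡ proj₁ v → u ≡ v
      vertex-≡ {u = u , p} {.u , q} refl = cong (u ,_) ([]=-irrelevant p q)

      to : Vertex (H [ C ]) → Vertex (path (length t))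
      to (w , w∈) = index (∈C⇒∈t w∈) , ∈⊤

      from : Vertex (path (length t)) → Vertex (H [ C ])
      from (i , _) = lookup t i , ∈t⇒∈C (∈-lookup i)

      position : ∀ (u : Vertex (H [ C ])) → proj₁ u ≡ lookup t (proj₁ (to u))
      position (u , u∈) = lookup-index (∈C⇒∈t u∈)

      Consecutive : (u v : Vertex (H [ C ])) → Set
      Consecutive u v = suc (toℕ (proj₁ (to u))) ≡ toℕ (proj₁ (to v))

      -- The edge might come from another tile `b`; disjointness forces `b` to be `a`, and
      -- distinctness of the entries then pins down both positions.
      next⇒consecutive : ∀ {b} u v → Next (tile b) (proj₁ u) (proj₁ v) → Consecutive u v
      next⇒consecutive u v p with disjoint (proj₁ (next-∈ p)) (∈C⇒∈t (proj₂ u))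
      ... | refl with next⇒lookup p
      ... | i , j , e , e′ , s = subst₂ (λ i j → suc (toℕ i) ≡ toℕ j)
        (unique-lookup (unique a) _ _ (trans (sym e) (position u)))
        (unique-lookup (unique a) _ _ (trans (sym e′) (position v))) s

      consecutive⇒next : ∀ u v → Consecutive u v → Next t (proj₁ u) (proj₁ v)
      consecutive⇒next u v s = subst₂ (Next t) (sym (position u)) (sym (position v)) (lookup⇒next t _ _ s)

    component≅path : H [ C ] ≅ path (length t)
    component≅path = record
      { vertices = mk↔ₛ′ to from
          (λ { (i , _) → vertex-≡ {F = path (length t)} 
            (unique-lookup (unique a) _ _ (sym (position (from (i , ∈⊤))))) })
          (λ u → vertex-≡ {F = H [ C ]} (sym (position u)))
      ; adjacent = λ u v → mk⇔
          (λ ((_ , p) , _) → Sum.map (next⇒consecutive u v) (next⇒consecutive v u) p)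
          (λ p → (a , Sum.map (consecutive⇒next u v) (consecutive⇒next v u) p) ,
                 proj₂ (x∈p∩q⁻ (V G) C (proj₂ u)) , proj₂ (x∈p∩q⁻ (V G) C (proj₂ v)))
      }

  tiling⇒factor : {ℱ : Pred (Σ ℕ Graph) (Level.suc 0ℓ)} → (∀ {l} → Size l → ℱ (l , path l)) → Factor ℱ G
  tiling⇒factor sizes = tilingGraph ,
    record { sameVertices = refl
           ; adjacent = λ (a , p) → [ edges a , Adj-sym G ∘ edges a ] p } ,
    λ C∈ → let v , v∈V , e = ∈-components⁻ tilingGraph C∈
               a , v∈ = cover v∈V
           in length (tile a) , path (length (tile a)) , sizes (size v∈) ,
              subst (λ C → tilingGraph [ C ] ≅ path (length (tile a))) (sym e) (component≅path v∈V v∈)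

-- The alternative to a tiling: `t` vertices are isolated at a cost of at most `ratio` deleted
-- vertices each.
record IsolatingSet (G : Graph n) (ratio : ℕ) : Set where
  field
    X          : Subset n
    X⊆V        : X ⊆ V G
    t          : ℕ
    t-positive : 0 < t
    t≤c₁       : t ≤ⁿ c 1 (G − X)
    ∣X∣≤       : ∣ X ∣ ≤ⁿ t * ratio

-- Alternating paths inside the classes of `Sep`.

module Paths (G : Graph n) (B : Barrier G)
             (missable : ∀ {v} → v ∈ Barrier.W B → Barrier.Missable B v) where

  open Barrier B

  -- `M` is itself a maximum matching, so it misses at most one vertex of a class. That vertex
  -- serves as the name of the class.
  class-exposed : ∀ {u v} → Exposed u → Exposed v → Sep u v → u ≡ v
  class-exposed (_ , Mu) (_ , Mv) s = s (M-matching , ≤-refl) Mu Mv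

  -- Edges inside `W` stay within a class, so matchings of `G [ W ]` do too.
  sep-mate : ∀ {N u v} → Matching G W N → v ∈ W → Sep u v → Sep u (N v)
  sep-mate {N} {u} {v} mat v∈ s with N v ≟ v
  ... | yes e = subst (Sep u) (sym e) s
  ... | no Nv = sep-trans (missable v∈) s (sep-adj (Matching.edge mat v Nv) v∈ (mate-within mat Nv))

  -- The path is listed from its end back to u; every second edge belongs to M.
  data Alternating (u : Fin n) : List (Fin n) → Set where
    start : Alternating u (u ∷ [])
    step  : ∀ {x y p} → Alternating u (x ∷ p) → Adj G x y → y ∈ W → y ∉ˡ x ∷ p →
            Alternating u (M y ∷ y ∷ x ∷ p)

  start∈ : ∀ {u p} → Alternating u p → u ∈ˡ p
  start∈ start          = here refl
  start∈ (step a _ _ _) = there (there (start∈ a))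

  class-alternating : ∀ {u p} → Exposed u → Alternating u p → ∀ {z} → z ∈ˡ p → z ∈ W × Sep u z
  class-alternating (u∈ , _) start (here refl) = u∈ , sep-refl
  class-alternating exp (step {x} {y} a xy y∈ _) z∈ = go z∈
    where
    x-class : x ∈ W × Sep _ x
    x-class = class-alternating exp a (here refl)

    y-sep : Sep _ y
    y-sep = sep-trans (missable (proj₁ x-class)) (proj₂ x-class) (sep-adj xy (proj₁ x-class) y∈)

    My∈ : M y ∈ W
    My∈ with M y ≟ y
    ... | yes e = subst (_∈ W) (sym e) y∈
    ... | no My = mate-within M-matching My

    go : ∀ {z} → z ∈ˡ _ → z ∈ W × Sep _ z
    go (here refl)         = My∈ , sep-mate M-matching y∈ y-sep
    go (there (here refl)) = y∈ , y-sep
    go (there (there z∈))  = class-alternating exp a z∈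

  module _ {u : Fin n} (exp : Exposed u) where

    -- If `M` missed `y`, then `y` would be the exposed vertex of its class, namely `u`, which is on
    -- the path.
    off-path-covered : ∀ {x y p} → Alternating u (x ∷ p) → Adj G x y → y ∈ W → y ∉ˡ x ∷ p → M y ≢ y
    off-path-covered a xy y∈ y∉ My = y∉ (subst (_∈ˡ _)
      (class-exposed exp (y∈ , My) (proj₂ (class-alternating exp (step a xy y∈ y∉) (there (here refl))))) (start∈ a))

    -- The path consists of `u` and of whole edges of `M`; hence taking it out leaves `M` intact on
    -- the other vertices.
    closed-alternating : ∀ {p} → Alternating u p → ∀ {z} → z ∈ˡ p → M z ∈ˡ p
    closed-alternating start (here refl)                        = here (proj₂ exp)
    closed-alternating (step a _ _ _) (here refl)               = there (here (Matching.involutive M-matching _))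
    closed-alternating (step a _ _ _) (there (here refl))       = here refl
    closed-alternating (step a _ _ _) (there (there z∈))        = there (there (closed-alternating a z∈))

    unique-alternating : ∀ {p} → Alternating u p → Unique p
    unique-alternating start = [] ∷ []
    unique-alternating (step {x} {y} {p} a xy y∈ y∉) = unique-∷ My∉ (unique-∷ y∉ (unique-alternating a))
      where
      My∉ : M y ∉ˡ y ∷ x ∷ p
      My∉ (here e)    = off-path-covered a xy y∈ y∉ e
      My∉ (there My∈) = y∉ (subst (_∈ˡ x ∷ p) (Matching.involutive M-matching y) (closed-alternating a My∈))

    edge-alternating : ∀ {p} → Alternating u p → ∀ {a b} → Next p a b → Adj G a b
    edge-alternating start (there ())
    edge-alternating (step {x} {y} a xy y∈ y∉) here =
      Adj-sym G (Matching.edge M-matching y (off-path-covered a xy y∈ y∉))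
    edge-alternating (step a xy _ _) (there here) = Adj-sym G xy
    edge-alternating (step a _ _ _) (there (there p)) = edge-alternating a p

  Stuck : List (Fin n) → Set
  Stuck []      = False
  Stuck (x ∷ p) = ∀ {y} → y ∈ W → Adj G x y → y ∈ˡ x ∷ p

  -- Each `step` adds two vertices, so `i` steps give `2 * i + 1`. A path stuck earlier has a
  -- smaller odd length and so fits within `2 * i`.
  longPath : ∀ u i → ∃ λ p → Alternating u p ×
             (length p ≡ suc (2 * i) ⊎ (Stuck p × length p ≤ⁿ 2 * i))
  longPath u zero = u ∷ [] , start , inj₁ refl
  longPath u (suc i) with longPath u i
  ... | p , a , inj₂ (stuck , len) = p , a , inj₂ (stuck , ≤-trans len (ℕₚ.*-monoʳ-≤ 2 (ℕₚ.n≤1+n i)))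
  ... | x ∷ p , a , inj₁ len with any? (λ y → (y ∈? W) ×-dec Adj? G x y ×-dec ¬? (y ∈ˡ? x ∷ p))
  ...   | yes (y , y∈ , xy , y∉) = M y ∷ y ∷ x ∷ p , step a xy y∈ y∉ ,
          inj₁ (trans (cong (λ l → suc (suc l)) len) (cong suc (sym (ℕₚ.*-suc 2 i))))
  ...   | no none = x ∷ p , a , inj₂
          ((λ {y} y∈ xy → decidable-stable (y ∈ˡ? x ∷ p) λ y∉ → none (y , y∈ , xy , y∉)) ,
           ≤-trans (ℕₚ.≤-reflexive len) (≤-trans (ℕₚ.n≤1+n _) (ℕₚ.≤-reflexive (sym (ℕₚ.*-suc 2 i)))))

  module WithLength (k : ℕ) where

    P : Fin n → List (Fin n)
    P u = proj₁ (longPath u k)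

    P-alternating : ∀ u → Alternating u (P u)
    P-alternating u = proj₁ (proj₂ (longPath u k))

    Good : Fin n → Set
    Good u = length (P u) ≡ suc (2 * k)

    good? : Decidable Good
    good? u = length (P u) ℕ.≟ suc (2 * k)

    bad⇒stuck : ∀ {u} → ¬ Good u → Stuck (P u) × length (P u) ≤ⁿ 2 * k
    bad⇒stuck {u} ¬good = Sum.fromInj₂ (λ good → contradiction good ¬good) (proj₂ (proj₂ (longPath u k)))

    P-class : ∀ {u} → Exposed u → ∀ {z} → z ∈ˡ P u → z ∈ W × Sep u z
    P-class {u} exp = class-alternating exp (P-alternating u)

    -- A common vertex would put `u` and `v` in one class, which has only one exposed vertex.
    P-disjoint : ∀ {u v z} → Exposed u → Exposed v → z ∈ˡ P u → z ∈ˡ P v → u ≡ v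
    P-disjoint eu ev zu zv = let z∈ , su = P-class eu zu in
      class-exposed eu ev (sep-trans (missable z∈) su (sep-sym (proj₂ (P-class ev zv))))

    -- Adjacency of `s` to the class named `u`; the neighbour `x` may be any vertex of that class.
    Attached : Fin n → Fin n → Set
    Attached s u = ∃ λ x → x ∈ W × Adj G s x × Sep u x

    attached? : ∀ s u → Dec (Attached s u)
    attached? s u = any? λ x → (x ∈? W) ×-dec Adj? G s x ×-dec sep? u x

    open Hall deleted? exposed? good? attached? public

    -- The tiling from an assignment with nothing lacking.

    module Matched (a : Assignment) (¬lacking : ∀ {u} → ¬ Lacking a u) where

      open Assignment a renaming (target to ψ)

      attachment : ∃ λ (att : Fin n → Fin n) → ∀ s → Deleted s →
                   att s ∈ W × Adj G s (att s) × Sep (ψ s) (att s)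
      attachment = choose deleted? id λ _ → related

      att : Fin n → Fin n
      att = proj₁ attachment

      module _ {s : Fin n} (del : Deleted s) where
        att∈ : att s ∈ W
        att∈ = proj₁ (proj₂ attachment s del)

        att-adj : Adj G s (att s)
        att-adj = proj₁ (proj₂ (proj₂ attachment s del))

        att-sep : Sep (ψ s) (att s)
        att-sep = proj₂ (proj₂ (proj₂ attachment s del))

      missing : ∃ λ (N : Fin n → Fin n → Fin n) → ∀ v → v ∈ W → Opt (N v) × N v v ≡ v
      missing = choose (_∈? W) (λ _ → M) λ _ → missable

      N : Fin n → Fin n → Fin n
      N = proj₁ missing

      N-opt : ∀ {v} → v ∈ W → Opt (N v)
      N-opt {v} v∈ = proj₁ (proj₂ missing v v∈)

      N-missing : ∀ {v} → v ∈ W → N v v ≡ v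
      N-missing {v} v∈ = proj₂ (proj₂ missing v v∈)

      -- M, modified inside the class matched to each deleted vertex s: there it
      -- becomes a matching missing att s, and att s is joined to s.
      data Mate : Fin n → Fin n → Set where
        out   : ∀ {s w} → Deleted s → w ≡ att s → Mate s w
        back  : ∀ {s v} → Deleted s → v ≡ att s → Mate v s
        moved : ∀ {s v w} → Deleted s → v ∈ W → Sep (ψ s) v → v ≢ att s → w ≡ N (att s) v → Mate v w
        kept  : ∀ {v w} → v ∈ W → (∀ {s} → Deleted s → ¬ Sep (ψ s) v) → w ≡ M v → Mate v w

      mate-total : ∀ v → v ∈ V G → ∃ (Mate v)
      mate-total v v∈V with v ∈? W
      ... | no v∉ = att v , out (v∈V , v∉) refl
      ... | yes v∈ with any? (λ s → deleted? s ×-dec sep? (ψ s) v)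
      ...   | no none = M v , kept v∈ (λ {s} del sep → none (s , del , sep)) refl
      ...   | yes (s , del , sep) with v ≟ att s
      ...     | yes e = s , back del e
      ...     | no v≢ = N (att s) v , moved del v∈ sep v≢ refl

      -- `N (att s)` already misses `att s`, so it misses no other vertex of the same class.
      moved-covered : ∀ {s v} → Deleted s → Sep (ψ s) v → v ≢ att s → N (att s) v ≢ v
      moved-covered {s} {v} del sep v≢ e = v≢ (sym
        (sep-trans (missable (proj₁ (into del))) (sep-sym (att-sep del)) sep (N-opt (att∈ del)) (N-missing (att∈ del)) e))

      mate-sym : ∀ {v w} → Mate v w → Mate w v
      mate-sym (out del e)  = back del e
      mate-sym (back del e) = out del e
      mate-sym (moved {s} {v} del v∈ sep v≢ refl) = moved del
        (mate-within mat (moved-covered del sep v≢)) (sep-mate mat v∈ sep)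
        (λ e → v≢ (mate-injective mat (trans e (sym (N-missing (att∈ del))))))
        (sym (Matching.involutive mat v))
        where mat = proj₁ (N-opt (att∈ del))
      mate-sym (kept {v} v∈ none refl) = kept Mv∈
        (λ del sep → none del (subst (Sep _) (Matching.involutive M-matching v) (sep-mate M-matching Mv∈ sep)))
        (sym (Matching.involutive M-matching v))
        where
        Mv∈ : M v ∈ W
        Mv∈ with M v ≟ v
        ... | yes e = subst (_∈ W) (sym e) v∈
        ... | no Mv = mate-within M-matching Mv

      -- The targets of `s` and `s′` would be exposed vertices of one class, hence equal, and
      -- targets are injective.
      owner-unique : ∀ {s s′ v} → Deleted s → Deleted s′ → v ∈ W → Sep (ψ s) v → Sep (ψ s′) v → s ≡ s′
      owner-unique d d′ v∈ sep sep′ = injective d d′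
        (class-exposed (into d) (into d′) (sep-trans (missable v∈) sep (sep-sym sep′)))

      mate-unique : ∀ {v w w′} → Mate v w → Mate v w′ → w ≡ w′
      mate-unique (out _ e) (out _ e′) = trans e (sym e′)
      mate-unique (out (_ , v∉) _) (back d refl)         = contradiction (att∈ d) v∉
      mate-unique (out (_ , v∉) _) (moved _ v∈ _ _ _)    = contradiction v∈ v∉
      mate-unique (out (_ , v∉) _) (kept v∈ _ _)         = contradiction v∈ v∉
      mate-unique (back d refl) (out (_ , v∉) _)         = contradiction (att∈ d) v∉
      mate-unique (back d refl) (back d′ e)              =
        owner-unique d d′ (att∈ d) (att-sep d) (subst (Sep _) (sym e) (att-sep d′))
      mate-unique (back d refl) (moved d′ v∈ sep v≢ _) with owner-unique d d′ v∈ (att-sep d) sep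
      ... | refl = contradiction refl v≢
      mate-unique (back d refl) (kept _ none _)          = ⊥-elim (none d (att-sep d))
      mate-unique (moved _ v∈ _ _ _) (out (_ , v∉) _)    = contradiction v∈ v∉
      mate-unique (moved d′ v∈ sep v≢ _) (back d refl) with owner-unique d d′ v∈ (att-sep d) sep
      ... | refl = contradiction refl v≢
      mate-unique (moved d v∈ sep _ e) (moved d′ _ sep′ _ e′) with owner-unique d d′ v∈ sep sep′
      ... | refl = trans e (sym e′)
      mate-unique (moved d _ sep _ _) (kept _ none _)    = ⊥-elim (none d sep)
      mate-unique (kept v∈ _ _) (out (_ , v∉) _)         = contradiction v∈ v∉
      mate-unique (kept _ none _) (back d refl)          = ⊥-elim (none d (att-sep d))
      mate-unique (kept _ none _) (moved d _ sep _ _)    = ⊥-elim (none d sep)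
      mate-unique (kept _ _ e) (kept _ _ e′)             = trans e (sym e′)

      mate-adj : ∀ {v w} → Mate v w → v ≢ w → Adj G v w
      mate-adj (out d refl) _  = att-adj d
      mate-adj (back d refl) _ = Adj-sym G (att-adj d)
      mate-adj (moved d v∈ sep v≢ refl) v≢w = Matching.edge (proj₁ (N-opt (att∈ d))) _ (v≢w ∘ sym)
      mate-adj (kept _ _ refl) v≢w = Matching.edge M-matching _ (v≢w ∘ sym)

      mate∈V : ∀ {v w} → Mate v w → v ∈ V G
      mate∈V (out d _)          = proj₁ d
      mate∈V (back d refl)      = W⊆V (att∈ d)
      mate∈V (moved _ v∈ _ _ _) = W⊆V v∈
      mate∈V (kept v∈ _ _)      = W⊆V v∈

      Free : Fin n → Set
      Free u = Exposed u × ¬ Hit a u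

      free? : Decidable Free
      free? u = exposed? u ×-dec ¬? (hit? a u)

      free-good : ∀ {u} → Free u → Good u
      free-good {u} (exp , ¬hit) = decidable-stable (good? u) λ ¬good → ¬lacking (exp , ¬good , ¬hit)

      -- `out` and `back` join a vertex outside `W` to one inside, and `moved` has no fixed point by
      -- `moved-covered`. What remains are the exposed vertices of classes without an owner.
      fixed⇒free : ∀ {v} → Mate v v → Free v
      fixed⇒free (out d e)  = contradiction (subst (_∈ W) (sym e) (att∈ d)) (proj₂ d)
      fixed⇒free (back d e) = contradiction (subst (_∈ W) (sym e) (att∈ d)) (proj₂ d)
      fixed⇒free (moved d v∈ sep v≢ e) = contradiction (sym e) (moved-covered d sep v≢)
      fixed⇒free (kept v∈ none e) = (v∈ , sym e) , λ { (s , d , refl) → none d sep-refl }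

      OnPath : Fin n → Set
      OnPath v = ∃ λ u → Free u × v ∈ˡ P u

      onPath? : Decidable OnPath
      onPath? v = any? λ u → free? u ×-dec (v ∈ˡ? P u)

      -- The class of a free vertex is owned by no deleted vertex, so `M` is unchanged there. As the
      -- path is closed under `M`, the vertices off all chosen paths are matched among themselves.
      onPath-kept : ∀ {u v} → Free u → v ∈ˡ P u → Mate v (M v)
      onPath-kept (exp , ¬hit) v∈P = let v∈ , sep = P-class exp v∈P in
        kept v∈ (λ d sep′ → ¬hit (_ , d , class-exposed (into d) exp (sep-trans (missable v∈) sep′ (sep-sym sep)))) refl

      mates : ∃ λ (f : Fin n → Fin n) → ∀ v → v ∈ V G → Mate v (f v)
      mates = choose (_∈? V G) id mate-total

      f : Fin n → Fin n
      f = proj₁ mates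

      f-mate : ∀ {v} → v ∈ V G → Mate v (f v)
      f-mate {v} = proj₂ mates v

      f∈V : ∀ {v} → v ∈ V G → f v ∈ V G
      f∈V = mate∈V ∘ mate-sym ∘ f-mate

      f-involutive : ∀ {v} → v ∈ V G → f (f v) ≡ v
      f-involutive v∈ = mate-unique (f-mate (f∈V v∈)) (mate-sym (f-mate v∈))

      f-onPath : ∀ {v} → v ∈ V G → OnPath v → OnPath (f v)
      f-onPath v∈ (u , free , v∈P) = u , free ,
        subst (_∈ˡ P u) (mate-unique (onPath-kept free v∈P) (f-mate v∈))
          (closed-alternating (proj₁ free) (P-alternating u) v∈P)

      -- The smaller end names a matching edge, so that each edge becomes one tile only.
      EdgeKey : Fin n → Set
      EdgeKey v = v ∈ V G × ¬ OnPath v × toℕ v < toℕ (f v)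

      edgeKey? : Decidable EdgeKey
      edgeKey? v = (v ∈? V G) ×-dec ¬? (onPath? v) ×-dec (toℕ v <? toℕ (f v))

      -- The decisions are passed as arguments so that later proofs can split on them directly.
      tileOf : ∀ v → Dec (Free v) → Dec (EdgeKey v) → List (Fin n)
      tileOf v (yes _) _       = P v
      tileOf v (no _)  (yes _) = v ∷ f v ∷ []
      tileOf v (no _)  (no _)  = []

      tile : Fin n → List (Fin n)
      tile v = tileOf v (free? v) (edgeKey? v)

      tileView : ∀ v → (Free v × tile v ≡ P v) ⊎ (EdgeKey v × tile v ≡ v ∷ f v ∷ []) ⊎ tile v ≡ []
      tileView v = view (free? v) (edgeKey? v)
        where
        view : ∀ p q → (Free v × tileOf v p q ≡ P v) ⊎ (EdgeKey v × tileOf v p q ≡ v ∷ f v ∷ []) ⊎ tileOf v p q ≡ []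
        view (yes p) _       = inj₁ (p , refl)
        view (no _)  (yes q) = inj₂ (inj₁ (q , refl))
        view (no _)  (no _)  = inj₂ (inj₂ refl)

      tile-free : ∀ {v} → Free v → tile v ≡ P v
      tile-free {v} p = reduce (free? v)
        where
        reduce : ∀ d → tileOf v d (edgeKey? v) ≡ P v
        reduce (yes _) = refl
        reduce (no ¬p) = contradiction p ¬p

      tile-edge : ∀ {v} → EdgeKey v → tile v ≡ v ∷ f v ∷ []
      tile-edge {v} q = reduce (free? v) (edgeKey? v)
        where
        reduce : ∀ d e → tileOf v d e ≡ v ∷ f v ∷ []
        reduce (yes p) _       = contradiction (v , p , start∈ (P-alternating v)) (proj₁ (proj₂ q))
        reduce (no _)  (yes _) = refl
        reduce (no _)  (no ¬q) = contradiction q ¬q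

      ∈-tile : ∀ {b x} → x ∈ˡ tile b → (Free b × x ∈ˡ P b) ⊎ (EdgeKey b × (x ≡ b ⊎ x ≡ f b))
      ∈-tile {b} {x} x∈ with tileView b
      ... | inj₁ (p , e) = inj₁ (p , subst (x ∈ˡ_) e x∈)
      ... | inj₂ (inj₂ e) = case subst (x ∈ˡ_) e x∈ of λ ()
      ... | inj₂ (inj₁ (q , e)) with subst (x ∈ˡ_) e x∈
      ...   | here p         = inj₂ (q , inj₁ p)
      ...   | there (here p) = inj₂ (q , inj₂ p)

      key-off-path : ∀ {b x} → EdgeKey b → x ≡ b ⊎ x ≡ f b → ¬ OnPath x
      key-off-path (_ , off , _) (inj₁ refl) on = off on
      key-off-path (b∈ , off , _) (inj₂ refl) on =
        off (subst OnPath (f-involutive b∈) (f-onPath (f∈V b∈) on))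

      key-unique : ∀ {b c x} → EdgeKey b → EdgeKey c → x ≡ b ⊎ x ≡ f b → x ≡ c ⊎ x ≡ f c → b ≡ c
      key-unique _ _ (inj₁ refl) (inj₁ e) = e
      key-unique {c = c} (_ , _ , b<) (c∈ , _ , c<) (inj₁ refl) (inj₂ refl) =
        contradiction (subst (λ z → toℕ (f c) < toℕ z) (f-involutive c∈) b<) (<-asym c<)
      key-unique {b} (b∈ , _ , b<) (_ , _ , c<) (inj₂ refl) (inj₁ refl) =
        contradiction (subst (λ z → toℕ (f b) < toℕ z) (f-involutive b∈) c<) (<-asym b<)
      key-unique (b∈ , _) (c∈ , _) (inj₂ refl) (inj₂ e) =
        trans (sym (f-involutive b∈)) (trans (cong f e) (f-involutive c∈))

      tiling : Tiling G (λ l → l ≡ 2 ⊎ l ≡ 2 * k + 1)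
      tiling = record
        { tile = tile ; unique = tile-unique ; edges = tile-edges
        ; disjoint = λ {b} {c} → tile-disjoint {b} {c}
        ; contained = λ {b} → tile-contained {b} ; cover = tile-cover ; size = λ {b} → tile-size {b} }
        where
        tile-unique : ∀ b → Unique (tile b)
        tile-unique b with tileView b
        ... | inj₁ ((exp , _) , e) = subst Unique (sym e) (unique-alternating exp (P-alternating b))
        ... | inj₂ (inj₁ ((_ , _ , b<) , e)) =
              subst Unique (sym e) (unique-∷ (λ { (here p) → <-irrefl (cong toℕ p) b< }) ([] ∷ []))
        ... | inj₂ (inj₂ e) = subst Unique (sym e) []

        tile-edges : ∀ b {u v} → Next (tile b) u v → Adj G u v
        tile-edges b {u} {v} p with tileView b
        ... | inj₁ ((exp , _) , e) = edge-alternating exp (P-alternating b) (subst (λ t → Next t u v) e p)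
        ... | inj₂ (inj₂ e) = case subst (λ t → Next t u v) e p of λ ()
        ... | inj₂ (inj₁ ((b∈ , _ , b<) , e)) with subst (λ t → Next t u v) e p
        ...   | here            = mate-adj (f-mate b∈) (λ q → <-irrefl (cong toℕ q) b<)
        ...   | there (there ())

        tile-disjoint : ∀ {b c x} → x ∈ˡ tile b → x ∈ˡ tile c → b ≡ c
        tile-disjoint {b} {c} x∈ x∈′ with ∈-tile {b} x∈ | ∈-tile {c} x∈′
        ... | inj₁ (p , i) | inj₁ (p′ , i′) = P-disjoint (proj₁ p) (proj₁ p′) i i′
        ... | inj₁ (p , i) | inj₂ (q , j)   = contradiction (_ , p , i) (key-off-path q j)
        ... | inj₂ (q , j) | inj₁ (p , i)   = contradiction (_ , p , i) (key-off-path q j)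
        ... | inj₂ (q , j) | inj₂ (q′ , j′) = key-unique q q′ j j′

        tile-contained : ∀ {b x} → x ∈ˡ tile b → x ∈ V G
        tile-contained {b} x∈ with ∈-tile {b} x∈
        ... | inj₁ (p , i)                = W⊆V (proj₁ (P-class (proj₁ p) i))
        ... | inj₂ ((b∈ , _) , inj₁ refl) = b∈
        ... | inj₂ ((b∈ , _) , inj₂ refl) = f∈V b∈

        tile-cover : ∀ {v} → v ∈ V G → ∃ λ b → v ∈ˡ tile b
        tile-cover {v} v∈ with onPath? v
        ... | yes (u , p , i) = u , subst (v ∈ˡ_) (sym (tile-free p)) i
        ... | no off with <-cmp (toℕ v) (toℕ (f v))
        ...   | tri< v< _ _ = v , subst (v ∈ˡ_) (sym (tile-edge (v∈ , off , v<))) (here refl)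
        -- A vertex that is its own mate is free, and therefore starts one of the chosen paths.
        ...   | tri≈ _ e _ = contradiction
                (v , fixed⇒free (subst (Mate v) (sym (toℕ-injective e)) (f-mate v∈)) , start∈ (P-alternating v)) off
        ...   | tri> _ _ v> = f v , subst (v ∈ˡ_)
                (sym (tile-edge (f∈V v∈ , (λ on → off (subst OnPath (f-involutive v∈) (f-onPath (f∈V v∈) on))) ,
                                 subst (λ z → toℕ (f v) < toℕ z) (sym (f-involutive v∈)) v>)))
                (there (here (sym (f-involutive v∈))))

        tile-size : ∀ {b x} → x ∈ˡ tile b → length (tile b) ≡ 2 ⊎ length (tile b) ≡ 2 * k + 1
        tile-size {b} {x} x∈ with tileView b
        ... | inj₁ (p , e) = inj₂ (trans (cong length e) (trans (free-good p) (ℕₚ.+-comm 1 (2 * k))))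
        ... | inj₂ (inj₁ (_ , e)) = inj₁ (cong length e)
        ... | inj₂ (inj₂ e) = case subst (x ∈ˡ_) e x∈ of λ ()

    -- The isolating set from an obstruction.

    module Violation (o : Obstruction) where
      open Obstruction o renaming (members to T; unique to T-unique)
      open Assignment assignment

      hits? : ∀ u → Decidable (λ s → Deleted s × target s ≡ u)
      hits? u s = deleted? s ×-dec (target s ≟ u)

      hits≤1 : ∀ u → # (hits? u) ≤ⁿ 1
      hits≤1 u with any? (hits? u)
      ... | no none = ≤-trans (#≤length (hits? u) {[]} λ h → contradiction (_ , h) none) z≤n
      ... | yes (s , del , e) = #≤length (hits? u) {s ∷ []} λ (del′ , e′) → here (injective del′ del (trans e′ (sym e)))

      -- Paths are listed from their end. The default `u` is never taken for members of `T`, because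
      -- `Stuck` excludes the empty list.
      end : Fin n → Fin n
      end u = fromMaybe u (head (P u))

      rest : Fin n → List (Fin n)
      rest u = drop 1 (P u)

      -- At most one deleted vertex has target `u`, and it makes up for the omitted end; so the
      -- block is no longer than `P u`, that is, at most `2 * k`.
      block : Fin n → List (Fin n)
      block u = elements (hits? u) ++ rest u

      removed : List (Fin n)
      removed = concatMap block T

      X : Subset n
      X = fromList removed

      module _ {u : Fin n} (u∈ : u ∈ˡ T) where
        exp : Exposed u
        exp = proj₁ (bad u∈)

        private
          split : ∀ p → Stuck p → p ≡ fromMaybe u (head p) ∷ drop 1 p
          split (x ∷ p) _ = refl

          stuck-head : ∀ p → Stuck p → ∀ {y} → y ∈ W → Adj G (fromMaybe u (head p)) y → y ∈ˡ p
          stuck-head (x ∷ p) stuck = stuck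

          stuck : Stuck (P u)
          stuck = proj₁ (bad⇒stuck (proj₂ (bad u∈)))

        P-split : P u ≡ end u ∷ rest u
        P-split = split (P u) stuck

        end∈P : end u ∈ˡ P u
        end∈P = subst (end u ∈ˡ_) (sym P-split) (here refl)

        rest⊆P : ∀ {z} → z ∈ˡ rest u → z ∈ˡ P u
        rest⊆P z∈ = subst (_ ∈ˡ_) (sym P-split) (there z∈)

        end∉rest : end u ∉ˡ rest u
        end∉rest with subst Unique P-split (unique-alternating exp (P-alternating u))
        ... | e∉ ∷ _ = λ e∈ → All.lookup e∉ e∈ refl

        end∈W : end u ∈ W
        end∈W = proj₁ (P-class exp end∈P)

        end-sep : Sep u (end u)
        end-sep = proj₂ (P-class exp end∈P)

        block-length : length (block u) ≤ⁿ 2 * k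
        block-length = begin
          length (block u)             ≡⟨ length-++ (elements (hits? u)) ⟩
          # (hits? u) + length (rest u) ≤⟨ ℕₚ.+-monoˡ-≤ _ (hits≤1 u) ⟩
          suc (length (rest u))        ≡⟨ cong length P-split ⟨
          length (P u)                 ≤⟨ proj₂ (bad⇒stuck (proj₂ (bad u∈))) ⟩
          2 * k                        ∎
          where open ≤-Reasoning

        ∈-removed : ∀ {z} → z ∈ˡ block u → z ∈ X
        ∈-removed z∈ = ∈-fromList⁺ (∈-concatMap⁺ block (lose u∈ z∈))

        -- A neighbour in `W` lies on the stuck path and so in `rest u`. A neighbour outside `W` is
        -- attached to `u`, so `closed` puts its target into `T`.
        end-neighbour : ∀ {y} → Adj G (end u) y → y ∈ X
        end-neighbour {y} ey with y ∈? W
        ... | yes y∈ with subst (y ∈ˡ_) P-split (stuck-head (P u) stuck y∈ ey)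
        ...   | here refl = ⊥-elim (Adj-irrefl G refl ey)
        ...   | there y∈rest = ∈-removed (∈-++⁺ʳ (elements (hits? u)) y∈rest)
        -- The deleted neighbour `y` is found in the block of its own target, which need not be `u`.
        end-neighbour {y} ey | no y∉ = ∈-fromList⁺ (∈-concatMap⁺ block (lose
          (closed del u∈ (end u , end∈W , Adj-sym G ey , end-sep))
          (∈-++⁺ˡ (elements⁺ (hits? (target y)) (del , refl)))))
          where
          del : Deleted y
          del = Adj⇒∈V G (Adj-sym G ey) , y∉

      ∈-block : ∀ {z} → z ∈ X → ∃ λ u → u ∈ˡ T × (Deleted z ⊎ z ∈ˡ rest u)
      ∈-block z∈ =
        let u , u∈ , z∈block = find (∈-concatMap⁻ block {xs = T} (∈-fromList⁻ removed z∈))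
        in u , u∈ , Sum.map₁ (proj₁ ∘ elements⁻ (hits? u)) (∈-++⁻ (elements (hits? u)) z∈block)

      X⊆V : X ⊆ V G
      X⊆V z∈ with ∈-block z∈
      ... | u , u∈ , inj₁ del = proj₁ del
      ... | u , u∈ , inj₂ z∈rest = W⊆V (proj₁ (P-class (exp u∈) (rest⊆P u∈ z∈rest)))

      ∣X∣≤ : ∣ X ∣ ≤ⁿ length T * (2 * k)
      ∣X∣≤ = ≤-trans (∣fromList∣≤length removed) (length-concatMap block T (λ u∈ → block-length u∈))

      -- `X` contains deleted vertices, which are outside `W`, and paths without their ends;
      -- disjointness keeps an end off the other paths.
      end∉X : ∀ {u} → u ∈ˡ T → end u ∉ X
      end∉X {u} u∈ e∈ with ∈-block e∈
      ... | v , v∈ , inj₁ (_ , e∉W) = e∉W (end∈W u∈)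
      ... | v , v∈ , inj₂ e∈rest with P-disjoint (exp u∈) (exp v∈) (end∈P u∈) (rest⊆P v∈ e∈rest)
      ...   | refl = end∉rest u∈ e∈rest

      end-component : ∀ {u} → u ∈ˡ T → componentOf (G − X) (end u) ≡ ⁅ end u ⁆
      end-component {u} u∈ = ⊆-antisym
        (λ w∈ → subst (_∈ ⁅ end u ⁆) (alone (∈-componentOf⁻ (G − X) (end u) w∈)) (x∈⁅x⁆ (end u)))
        (λ {w} w∈ → subst (_∈ componentOf (G − X) (end u)) (sym (x∈⁅y⁆⇒x≡y _ w∈))
                      (∈-componentOf⁺ (G − X) (end u) ε))
        where
        alone : ∀ {w} → Connected (G − X) (end u) w → end u ≡ w
        alone ε = refl
        alone ((ey , _ , y∈∁X) ◅ _) = contradiction (end-neighbour u∈ ey) (x∈∁p⇒x∉p y∈∁X)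

      singletons : List (Subset n)
      singletons = map (componentOf (G − X) ∘ end) T

      -- Equal singleton components have the same end, and a shared end identifies the paths.
      singletons-unique : Unique singletons
      singletons-unique = unique-map T-unique λ u∈ v∈ e →
        P-disjoint (exp u∈) (exp v∈) (end∈P u∈) (subst (_∈ˡ P _) (sym (x∈⁅y⁆⇒x≡y _
          (subst (_ ∈_) (trans (sym (end-component u∈)) (trans e (end-component v∈))) (x∈⁅x⁆ _)))) (end∈P v∈))

      length≤c₁ : length T ≤ⁿ c 1 (G − X)
      length≤c₁ = ≤-trans (ℕₚ.≤-reflexive (sym (length-map _ T)))
        (unique-⊆-length singletons-unique λ C∈ →
          let u , u∈ , e = ∈-map⁻ (componentOf (G − X) ∘ end) C∈ in
          ∈-filter⁺ (λ C → ∣ C ∣ ℕ.≟ 1)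
            (subst (_∈ˡ components (G − X)) (sym e) (∈-components⁺ (G − X)
              (x∈p∩q⁺ (W⊆V (end∈W u∈) , x∉p⇒x∈∁p (end∉X u∈)))))
            (trans (cong ∣_∣ (trans e (end-component u∈))) (∣⁅x⁆∣≡1 (end u))))

      isolatingSet : IsolatingSet G (2 * k)
      isolatingSet = record
        { X = X ; X⊆V = X⊆V ; t = length T ; t-positive = ∈-length (proj₂ nonempty)
        ; t≤c₁ = length≤c₁ ; ∣X∣≤ = ∣X∣≤ }

    -- The barrier provides the first assignment: `φ s` is at once the name of a class and a
    -- neighbour of `s` in it.
    initial : Assignment
    initial = record
      { target = φ ; into = φ-exposed ; injective = φ-injective
      ; related = λ {s} del → φ s , proj₁ (φ-exposed del) , φ-adjacent del , sep-refl }

    tiling⊎isolatingSet : Tiling G (λ l → l ≡ 2 ⊎ l ≡ 2 * k + 1) ⊎ IsolatingSet G (2 * k)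
    tiling⊎isolatingSet = Sum.map
      (λ (a , ¬lacking) → Matched.tiling a ¬lacking) Violation.isolatingSet (saturate initial)

-- The dichotomy and the closing arithmetic.

pathTiling⊎isolatingSet : ∀ k (G : Graph n) → Tiling G (λ l → l ≡ 2 ⊎ l ≡ 2 * k + 1) ⊎ IsolatingSet G (2 * k)
pathTiling⊎isolatingSet k G =
  Paths.WithLength.tiling⊎isolatingSet G (proj₁ (gallaiBarrier G)) (proj₂ (gallaiBarrier G)) k

-- Passing to unnormalised rationals avoids reduction to lowest terms, after which the inequality is
-- one between integers.
cross-multiply : ∀ s x d .{{_ : ℕ.NonZero d}} →
                 (+ s) / 1 ≤ (+ 5 / d) *ℚ (+ x / 1) → s * d ≤ⁿ 5 * x
cross-multiply s x (suc d) h = ℤₚ.drop‿+≤+ (subst₂ ℤ._≤_ lhs rhs (ℚᵘₚ.drop-*≤* h′))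
  where
  h′ : mkℚᵘ (+ s) 0 ≤ᵘ mkℚᵘ (+ 5) d *ᵘ mkℚᵘ (+ x) 0
  h′ = ℚᵘₚ.≤-trans (ℚᵘₚ.≤-reflexive (ℚᵘₚ.≃-sym (ℚₚ.toℚᵘ-fromℚᵘ (mkℚᵘ (+ s) 0))))
       (ℚᵘₚ.≤-trans (ℚₚ.toℚᵘ-mono-≤ h)
       (ℚᵘₚ.≤-reflexive (ℚᵘₚ.≃-trans (ℚₚ.toℚᵘ-homo-* (+ 5 / suc d) (+ x / 1))
         (ℚᵘₚ.*-cong (ℚₚ.toℚᵘ-fromℚᵘ (mkℚᵘ (+ 5) d)) (ℚₚ.toℚᵘ-fromℚᵘ (mkℚᵘ (+ x) 0))))))

  lhs : + s ℤ.* + suc (d * 1) ≡ + (s * suc d)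
  lhs = trans (sym (ℤₚ.pos-* s _)) (cong (λ e → + (s * suc e)) (ℕₚ.*-identityʳ d))

  rhs : (+ 5 ℤ.* + x) ℤ.* + 1 ≡ + (5 * x)
  rhs = trans (ℤₚ.*-identityʳ _) (sym (ℤₚ.pos-* 5 x))

10k<6k² : ∀ {k} → 3 ≤ⁿ k → 10 * k < 6 * k ^ 2
10k<6k² {k} 3≤k = begin-strict
  -- `m≤m+n 11 7` is `11 ≤ 18`, that is, `10 < 18`; the 18 is `6 * 3`, with 3 the lower bound on
  -- `k`.
  10 * k            <⟨ ℕₚ.*-monoˡ-< k {{ℕ.>-nonZero (≤-trans (s≤s z≤n) 3≤k)}} (ℕₚ.m≤m+n 11 7) ⟩
  18 * k            ≡⟨ regroup k ⟩
  6 * (3 * (k * 1)) ≤⟨ ℕₚ.*-monoʳ-≤ 6 (ℕₚ.*-monoˡ-≤ (k * 1) 3≤k) ⟩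
  6 * k ^ 2         ∎
  where
  open ≤-Reasoning
  regroup : ∀ k → 18 * k ≡ 6 * (3 * (k * 1))
  regroup = solve-∀

-- Isolated vertices are the term `j = 0`. Matching on `s≤s` shows `k` to be a successor, so that
-- `upTo k` begins with it.
c₁≤sum : ∀ {k} → 3 ≤ⁿ k → (H : Graph n) → c 1 H ≤ⁿ sum (map (λ j → c (2 * j + 1) H) (upTo k))
c₁≤sum (s≤s _) H = ℕₚ.m≤m+n _ _

-- Isolated vertices alone break the bound: it would give `t * (6 * k ^ 2) ≤ 5 * ∣ X ∣ ≤ t * (10 *
-- k)` with `t` positive.
isolatingSet-dense : {G : Graph n} → ∀ {k} → 3 ≤ⁿ k → (I : IsolatingSet G (2 * k)) →
                     let open IsolatingSet I in ¬ (sum (map (λ j → c (2 * j + 1) (G − X)) (upTo k)) * (6 * k ^ 2) ≤ⁿ 5 * ∣ X ∣)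
isolatingSet-dense {n} {G} {k} 3≤k I sparse =
  <⇒≱ (ℕₚ.*-monoʳ-< t {{ℕ.>-nonZero t-positive}} (10k<6k² 3≤k)) (begin
    t * (6 * k ^ 2)   ≤⟨ ℕₚ.*-monoˡ-≤ (6 * k ^ 2) (≤-trans t≤c₁ (c₁≤sum 3≤k (G − X))) ⟩
    _                 ≤⟨ sparse ⟩
    5 * ∣ X ∣         ≤⟨ ℕₚ.*-monoʳ-≤ 5 ∣X∣≤ ⟩
    5 * (t * (2 * k)) ≡⟨ regroup t k ⟩
    t * (10 * k)      ∎)
  where
  open IsolatingSet I
  open ≤-Reasoning
  regroup : ∀ t k → 5 * (t * (2 * k)) ≡ t * (10 * k)
  regroup = solve-∀

theorem1 : (k : ℕ) (3≤k : 3 ≤ⁿ k) (n : ℕ) (G : Graph n) →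
    ((X : Subset n) → X ⊆ V G →
    (+ sum (map (λ j → c (2 * j + 1) (G − X)) (upTo k))) / 1
    ≤ _/_ (+ 5) (6 * k ^ 2) {{6k²≢0 3≤k}} *ℚ ((+ ∣ X ∣) / 1)) →
    Factor (｛ 2 , path 2 ｝ ∪ ｛ 2 * k + 1 , path (2 * k + 1) ｝) G
theorem1 k 3≤k n G sparse =
  tiling⇒factor (Sum.fromInj₁ (λ I → ⊥-elim (dense I)) (pathTiling⊎isolatingSet k G))
    λ { (inj₁ refl) → inj₁ refl ; (inj₂ refl) → inj₂ refl }
  where
  dense : ¬ IsolatingSet G (2 * k)
  dense I = isolatingSet-dense 3≤k I
    (cross-multiply (sum (map (λ j → c (2 * j + 1) (G − X)) (upTo k))) ∣ X ∣ (6 * k ^ 2)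
      {{6k²≢0 3≤k}} (sparse X X⊆V))
    where open IsolatingSet I
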